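{- There exists a planar graph $G$ that is $1$-defective $3$-correspondable but not $4$-correspondable.
   Context: All graphs are finite, simple and undirected. A correspondence cover of a graph $G$ is a pair $\mathcal{H}=(L,H)$ where $H$ is a graph and $L: V(G)\to 2^{V(H)}$ satisfies: (1) $\{L(v): v\in V(G)\}$ partitions $V(H)$; (2) each $L(v)$ is an independent set in $H$; (3) for all $u,v\in V(G)$, the edges of $H[L(u)\cup L(v)]$ form a matching, which is empty if $uv\notin E(G)$. The cover is $k$-fold if $|L(v)|\ge k$ for all $v$. Two colors $c,c'\in V(H)$ conflict if $cc'\in E(H)$. An $\mathcal{H}$-coloring is a map $\phi:V(G)\to V(H)$ with $\phi(v)\in L(v)$ for all $v$. It is $d$-defective if the subgraph of $H$ induced by the image of $\phi$ has maximum degree at most $d$, i.e., for every $v$, $\phi(v)$ conflicts with $\phi(u)$ for at most $d$ neighbors $u$ of $v$. A graph $G$ is $d$-defective $k$-correspondable if it has a $d$-defective $\mathcal{H}$-coloring for every $k$-fold correspondence cover $\mathcal{H}$ of $G$; it is $k$-correspondable if it is $0$-defective $k$-correspondable (i.e., every $k$-fold cover admits an $\mathcal{H}$-coloring whose image is independent in $H$). -}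

module Defs where

open import Data.Nat using (ℕ; zero; suc; _+_; _≤_)
open import Data.Bool using (Bool; true; false)
open import Data.Fin using (Fin; zero; suc)
open import Data.Product using (Σ; ∃; _×_; _,_)
open import Data.Sum using (_⊎_)
open import Data.Rational using (ℚ; 0ℚ; 1ℚ) renaming (_+_ to _+ℚ_; _*_ to _*ℚ_; _-_ to _-ℚ_; _≤_ to _≤ℚ_)
open import Relation.Nullary using (¬_)
open import Relation.Binary.PropositionalEquality using (_≡_; _≢_)

record Graph : Set where
  field
    n      : ℕ
    adj    : Fin n → Fin n → Bool
    sym    : ∀ u v → adj u v ≡ adj v u
    irrefl : ∀ v → adj v v ≡ false
open Graph public

count : ∀ {k} → (Fin k → Bool) → ℕ
count {zero}  f = 0
count {suc k} f with f zero
... | true  = suc (count (λ i → f (suc i)))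
... | false = count (λ i → f (suc i))

Point : Set
Point = ℚ × ℚ

OnSegment : Point → Point → Point → Set
OnSegment (px , py) (qx , qy) (x , y) =
  Σ ℚ λ t → (0ℚ ≤ℚ t) × (t ≤ℚ 1ℚ)
          × (x ≡ px +ℚ t *ℚ (qx -ℚ px))
          × (y ≡ py +ℚ t *ℚ (qy -ℚ py))

record PlaneDrawing (G : Graph) : Set where
  field
    pos       : Fin (n G) → Point
    injective : ∀ u v → pos u ≡ pos v → u ≡ v
    vertexOff : ∀ a b w → adj G a b ≡ true → w ≢ a → w ≢ b →
                ¬ OnSegment (pos a) (pos b) (pos w)
    noCross   : ∀ a b c d → adj G a b ≡ true → adj G c d ≡ true →
                ¬ ((a ≡ c × b ≡ d) ⊎ (a ≡ d × b ≡ c)) →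
                ∀ X → OnSegment (pos a) (pos b) X → OnSegment (pos c) (pos d) X →
                Σ (Fin (n G)) λ w → (w ≡ a ⊎ w ≡ b) × (w ≡ c ⊎ w ≡ d) × (X ≡ pos w)

Planar : Graph → Set
Planar G = PlaneDrawing G

-- Correspondence covers.
-- V(H) = disjoint union over v of L(v) = {v} × Fin (size v);
-- conflict u v i j  says that colour i ∈ L(u) and colour j ∈ L(v) are adjacent in H.

record Cover (G : Graph) : Set where
  field
    size     : Fin (n G) → ℕ
    conflict : (u v : Fin (n G)) → Fin (size u) → Fin (size v) → Bool
    conflict-sym : ∀ u v i j → conflict u v i j ≡ conflict v u j i
    conflict-indep : ∀ v i j → conflict v v i j ≡ false
    conflict-nonadj : ∀ u v i j → adj G u v ≡ false → conflict u v i j ≡ false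
    conflict-matching : ∀ u v i j j' → conflict u v i j ≡ true →
                        conflict u v i j' ≡ true → j ≡ j'
open Cover public

KFold : ∀ {G} → ℕ → Cover G → Set
KFold {G} k H = ∀ v → k ≤ size H v

Coloring : ∀ {G} → Cover G → Set
Coloring {G} H = (v : Fin (n G)) → Fin (size H v)

-- d-defective: each φ(v) conflicts with φ(u) for at most d vertices u
-- (conflicts only occur between neighbours of v)
Defective : ∀ {G} (H : Cover G) → ℕ → Coloring H → Set
Defective {G} H d φ = ∀ v → count (λ u → conflict H v u (φ v) (φ u)) ≤ d

DefectiveCorrespondable : ℕ → ℕ → Graph → Set
DefectiveCorrespondable d k G =
  (H : Cover G) → KFold k H → Σ (Coloring H) λ φ → Defective H d φ

Correspondable : ℕ → Graph → Set
Correspondable k G = DefectiveCorrespondable 0 k G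

{-# OPTIONS --safe #-}
module Submission where

-- The graph is assembled from copies of a gadget: six vertices x, z, a, d, p, q between two ends w and v,
-- with x, z, a adjacent to w, with x, z, d adjacent to v, and with x, z, p, q each adjacent to both a and d;
-- the remaining edges are xp, pq and qz.
-- With four colours a suitable cover makes one pair of colours of w and v inextensible.  With three colours
-- at most three of the nine pairs of end colours do not extend without conflicts at the ends, and these
-- extend at the price of a single conflict at w, or alternatively at v.
--
-- A block is an edge between a base vertex v and a hub w that are also the ends of three gadgets.  With four
-- colours it can forbid one colour of v, each gadget excluding one of the three colours left to w.  With three
-- colours every colour of v extends to the block with at most one conflict at v.  Some colour of v is safe,
-- that is, it needs none: if for all three colours of v both available colours of w were bad for two gadgets,
-- there would be at least 12 bad pairs, but three gadgets have at most 9.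
--
-- The graph is K₄ with a block at each vertex.  With four colours the blocks leave K₄ three colours.  With three
-- colours K₄ has a colouring in which every vertex has at most one conflict, and none unless its colour is safe.

open import Defs
open import Data.Bool using (Bool; true; false; _∧_; _∨_; not; T; if_then_else_)
open import Data.Bool.ListAction using () renaming (all to every)
open import Data.Bool.Properties using (T?; ∧-comm; ∧-identityʳ; ∧-zeroʳ)
open import Data.Empty using (⊥; ⊥-elim)
open import Data.Fin using (Fin; zero; suc; toℕ; combine; remQuot; inject≤; inject₁; #_)
import Data.Fin as F
import Data.Fin.Properties as Fₚ
open import Data.List using (List; map; filter; cartesianProduct; allFin) renaming ([] to []ₗ; _∷_ to _∷ₗ_)
open import Data.List.Membership.Propositional using (_∈_)
open import Data.List.Membership.Propositional.Properties using (∈-filter⁺; ∈-cartesianProduct⁺; ∈-allFin; ∈-map⁺)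
open import Data.List.Relation.Unary.Any using (here; there)
open import Data.Maybe using (Maybe; just; nothing; maybe; is-just)
open import Data.Nat using (ℕ; zero; suc; _+_; _*_; _∸_; _≤_; _<_; _≤ᵇ_; _<ᵇ_; _≡ᵇ_; z≤n; s≤s)
import Data.Nat.Properties as ℕₚ
open import Algebra.Properties.CommutativeMonoid.Sum ℕₚ.+-0-commutativeMonoid using (sum; ∑-comm; sum-cong-≋)
open import Data.Product using (Σ; ∃; ∃₂; _×_; _,_; proj₁; proj₂; Σ-syntax; uncurry)
open import Data.Rational using (ℚ; 0ℚ; 1ℚ; 1/_; ≢-nonZero; nonNegative) renaming (_+_ to _+ℚ_; _*_ to _*ℚ_; _-_ to _-ℚ_; _≤_ to _≤ℚ_; _<_ to _<ℚ_)
import Data.Rational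
import Data.Rational.Properties as ℚₚ
open import Data.Rational.Solver using (module +-*-Solver)
open +-*-Solver using (solve; _:=_; _:+_; _:*_; _:-_; :-_; con)
open import Data.Sum using (_⊎_; inj₁; inj₂; [_,_]′)
open import Data.Vec using (Vec; []; _∷_; lookup)
open import Data.Vec.Relation.Binary.Pointwise.Inductive as Pointwise using (Pointwise; []; _∷_)
open import Relation.Binary.Definitions using (tri<; tri≈; tri>)
open import Relation.Binary.PropositionalEquality using (_≡_; _≢_; refl; cong; cong₂; trans; subst; subst₂; ≢-sym) renaming (sym to ≡-sym)
open import Relation.Nullary using (¬_; yes; no)

-- Statements over finite types that are proved by evaluation

-- One syntax carries both the Boolean `eval` and the proposition `⟦_⟧`, so each finite check is a
-- `refl` passed to `decide`. The guard in `unless_then_` is stated negatively because `_∨_` then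
-- skips the body as soon as the guard is true.
data Form : Set where
  ⟨_⟩     : Bool → Form
  ∀′ ∃′   : ∀ {n} → (Fin n → Form) → Form
  ∀ᵇ      : (Bool → Form) → Form
  _∨′_    : Form → Form → Form
  unless_then_ : Bool → Form → Form

infixr 3 unless_then_
infixr 4 _∨′_

all any : ∀ {n} → (Fin n → Bool) → Bool
all {zero}  f = true
all {suc n} f = f zero ∧ all (λ i → f (suc i))
any {zero}  f = false
any {suc n} f = f zero ∨ any (λ i → f (suc i))

eval : Form → Bool
eval ⟨ b ⟩ = b
eval (∀′ f) = all λ i → eval (f i)
eval (∃′ f) = any λ i → eval (f i)
eval (∀ᵇ f) = eval (f false) ∧ eval (f true)
eval (φ ∨′ ψ) = eval φ ∨ eval ψ
eval (unless b then φ) = b ∨ eval φ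

⟦_⟧ : Form → Set
⟦ ⟨ b ⟩ ⟧ = b ≡ true
⟦ ∀′ f ⟧ = ∀ i → ⟦ f i ⟧
⟦ ∃′ f ⟧ = ∃ λ i → ⟦ f i ⟧
⟦ ∀ᵇ f ⟧ = ∀ b → ⟦ f b ⟧
⟦ φ ∨′ ψ ⟧ = ⟦ φ ⟧ ⊎ ⟦ ψ ⟧
⟦ unless b then φ ⟧ = b ≡ false → ⟦ φ ⟧

∧-split : ∀ {x y} → x ∧ y ≡ true → x ≡ true × y ≡ true
∧-split {true} {true} _ = refl , refl

∨-split : ∀ {x y} → x ∨ y ≡ true → x ≡ true ⊎ y ≡ true
∨-split {true}  _ = inj₁ refl
∨-split {false} p = inj₂ p

∨-right : ∀ {x y} → x ∨ y ≡ true → x ≡ false → y ≡ true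
∨-right p refl = p

all-sound : ∀ {n} (f : Fin n → Bool) → all f ≡ true → ∀ i → f i ≡ true
all-sound f p zero    = proj₁ (∧-split p)
all-sound f p (suc i) = all-sound (λ i → f (suc i)) (proj₂ (∧-split {f zero} p)) i

any-sound : ∀ {n} (f : Fin n → Bool) → any f ≡ true → ∃ λ i → f i ≡ true
any-sound {suc n} f p with ∨-split {f zero} p
... | inj₁ q = zero , q
... | inj₂ q with any-sound (λ i → f (suc i)) q
...   | i , r = suc i , r

decide : ∀ φ → eval φ ≡ true → ⟦ φ ⟧
decide ⟨ b ⟩ p = p
decide (∀′ f) p i = decide (f i) (all-sound (λ i → eval (f i)) p i)
decide (∃′ f) p with any-sound (λ i → eval (f i)) p
... | i , q = i , decide (f i) q
decide (∀ᵇ f) p false = decide (f false) (proj₁ (∧-split p))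
decide (∀ᵇ f) p true  = decide (f true) (proj₂ (∧-split {eval (f false)} p))
decide (φ ∨′ ψ) p with ∨-split {eval φ} p
... | inj₁ q = inj₁ (decide φ q)
... | inj₂ q = inj₂ (decide ψ q)
decide (unless b then φ) p b≡false = decide φ (∨-right p b≡false)

infix 5 _==_
_==_ : ∀ {n} → Fin n → Fin n → Bool
zero  == zero  = true
zero  == suc _ = false
suc _ == zero  = false
suc i == suc j = i == j

==-sound : ∀ {n} {i j : Fin n} → i == j ≡ true → i ≡ j
==-sound {i = zero}  {zero}  _ = refl
==-sound {i = suc i} {suc j} p = cong suc (==-sound p)

==-refl : ∀ {n} (i : Fin n) → i == i ≡ true
==-refl zero    = refl
==-refl (suc i) = ==-refl i

≢⇒== : ∀ {n} {i j : Fin n} → i ≢ j → i == j ≡ false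
≢⇒== {i = i} {j} i≢j with i == j in eq
... | true  = ⊥-elim (i≢j (==-sound eq))
... | false = refl

==⇒≢ : ∀ {n} {i j : Fin n} → i == j ≡ false → i ≢ j
==⇒≢ {i = i} p refl with trans (≡-sym (==-refl i)) p
... | ()

true≢false : ∀ {b : Bool} → b ≡ true → b ≡ false → ⊥
true≢false refl ()

not-true : ∀ {b} → not b ≡ true → b ≡ false
not-true {false} _ = refl

-- Three colours and their permutations

Color : Set
Color = Fin 3

avoid : ∀ (x y : Color) → Σ[ z ∈ Color ] z ≢ x × z ≢ y
avoid zero zero = suc zero , (λ ()) , (λ ())
avoid zero (suc zero) = suc (suc zero) , (λ ()) , (λ ())
avoid zero (suc (suc zero)) = suc zero , (λ ()) , (λ ())
avoid (suc zero) zero = suc (suc zero) , (λ ()) , (λ ())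
avoid (suc zero) (suc y) = zero , (λ ()) , (λ ())
avoid (suc (suc zero)) zero = suc zero , (λ ()) , (λ ())
avoid (suc (suc zero)) (suc y) = zero , (λ ()) , (λ ())

rainbow? : ∀ (x y z : Color) →
  (Σ[ e ∈ Color ] e ≢ x × e ≢ y × e ≢ z) ⊎ (x ≢ y × x ≢ z × y ≢ z)
rainbow? x y z with x F.≟ y | x F.≟ z | y F.≟ z
... | yes refl | _ | _ = let e , p , q = avoid x z in inj₁ (e , p , p , q)
... | no _ | yes refl | _ = let e , p , q = avoid x y in inj₁ (e , p , q , p)
... | no _ | no _ | yes refl = let e , p , q = avoid x y in inj₁ (e , p , q , q)
... | no p | no q | no r = inj₂ (p , q , r)

-- The six permutations are numbered, so that `∀′` can range over them; `zero` is the identity.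
Perm : Set
Perm = Fin 6

infixr 9 _$_
_$_ : Perm → Color → Color
zero                                $ c              = c
suc zero                            $ zero           = zero
suc zero                            $ suc zero       = suc (suc zero)
suc zero                            $ suc (suc zero) = suc zero
suc (suc zero)                      $ zero           = suc zero
suc (suc zero)                      $ suc zero       = zero
suc (suc zero)                      $ suc (suc zero) = suc (suc zero)
suc (suc (suc zero))                $ zero           = suc zero
suc (suc (suc zero))                $ suc zero       = suc (suc zero)
suc (suc (suc zero))                $ suc (suc zero) = zero
suc (suc (suc (suc zero)))          $ zero           = suc (suc zero)
suc (suc (suc (suc zero)))          $ suc zero       = zero
suc (suc (suc (suc zero)))          $ suc (suc zero) = suc zero
suc (suc (suc (suc (suc zero))))    $ zero           = suc (suc zero)
suc (suc (suc (suc (suc zero))))    $ suc zero       = suc zero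
suc (suc (suc (suc (suc zero))))    $ suc (suc zero) = zero

$-≢ : ∀ π {i j} → i ≢ j → π $ i ≢ π $ j
$-≢ π {i} {j} i≢j p = true≢false (==-refl (π $ j))
  (subst (λ c → c == π $ j ≡ false) p (not-true (decide distinctness refl π i j (≢⇒== i≢j))))
  where
  distinctness = ∀′ {6} λ π → ∀′ λ i → ∀′ λ j → unless i == j then ⟨ not (π $ i == π $ j) ⟩

$-injective : ∀ π {i j} → π $ i ≡ π $ j → i ≡ j
$-injective π {i} {j} p with i F.≟ j
... | yes i≡j = i≡j
... | no  i≢j = ⊥-elim ($-≢ π i≢j p)

-- Choosing p and q once the rest of a gadget is coloured

bit : Bool → ℕ
bit true  = 1
bit false = 0

-- The bracketing and the final 0 agree with the unfolding of `sum`, so that row sums of conflicts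
-- reduce to these expressions.
one-of₄ : (b₀ b₁ b₂ b₃ : Bool) → Bool
one-of₄ b₀ b₁ b₂ b₃ = bit b₀ + (bit b₁ + (bit b₂ + (bit b₃ + 0))) ≤ᵇ 1

one-of₅ : (b₀ b₁ b₂ b₃ b₄ : Bool) → Bool
one-of₅ b₀ b₁ b₂ b₃ b₄ = bit b₀ + (bit b₁ + (bit b₂ + (bit b₃ + (bit b₄ + 0)))) ≤ᵇ 1

-- One flag for each edge of a gadget, telling whether its ends conflict; wv is not an edge of the gadget.
valid : (wx vx wz vz wa vd xa za xd zd xp zq ap dp aq dq qp : Bool) → Bool
valid wx vx wz vz wa vd xa za xd zd xp zq ap dp aq dq qp =
  one-of₄ xp ap dp qp ∧ (one-of₄ zq aq dq qp ∧ (one-of₅ wx vx xa xd xp ∧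
  (one-of₅ wz vz za zd zq ∧ (one-of₅ wa xa za ap aq ∧ one-of₅ vd xd zd dp dq))))

-- A colour of a or d: does it conflict with the end (w or v), x, z, and with which colours of p and q?
record Candidate : Set where
  constructor cand
  field
    fromEnd fromX fromZ : Bool
    onP onQ : Color
open Candidate

validAt : (wx vx wz vz : Bool) (px qz : Color) (A D : Candidate) (p q : Color) → Bool
validAt wx vx wz vz px qz A D p q =
  valid wx vx wz vz (fromEnd A) (fromEnd D) (fromX A) (fromZ A) (fromX D) (fromZ D)
    (px == p) (qz == q) (onP A == p) (onP D == p) (onQ A == q) (onQ D == q) (q == p)

fits : (wx vx wz vz : Bool) (px qz : Color) (A D : Candidate) → Form
fits wx vx wz vz px qz A D = ∃′ λ p → ∃′ λ q → ⟨ validAt wx vx wz vz px qz A D p q ⟩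

fits₀ : (px qz : Color) (A D : Candidate) → Form
fits₀ = fits false false false false

clean : Color → Color → Candidate
clean = cand false false false

∀≢ : (Color → Color → Form) → Form
∀≢ f = ∀′ λ i → ∀′ λ j → unless i == j then f i j

Pairing : Set
Pairing = (px qz : Color) (A D : Candidate) → Form

-- Exchanges the roles of a and d, hence of w and v. The evaluated facts are checked in both forms,
-- so that later arguments can be stated for one side only.
mirrored : Pairing → Pairing
mirrored f px qz A D = f px qz D A

-- In these forms px and qz are the colours of p and q that conflict with x and z.
cleanClean : (wx vx : Bool) → Form
cleanClean wx vx = ∀′ λ px → ∀′ λ qz → ∀′ λ pa → ∀′ λ qa → ∀′ λ pd → ∀′ λ qd →
  fits wx vx false false px qz (clean pa qa) (clean pd qd)

clean-clean : ∀ wx vx → wx ∧ vx ≡ false → ⟦ cleanClean wx vx ⟧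
clean-clean = decide (∀ᵇ λ wx → ∀ᵇ λ vx → unless wx ∧ vx then cleanClean wx vx) refl

endClean : Pairing → Form
endClean f = ∀′ λ px → ∀′ λ qz → ∀′ λ pa → ∀′ λ qa → ∀′ λ pd → ∀′ λ qd →
  f px qz (cand true false false pa qa) (clean pd qd)

end-clean : ⟦ endClean fits₀ ⟧
end-clean = decide (endClean fits₀) refl

clean-end : ⟦ endClean (mirrored fits₀) ⟧
clean-end = decide (endClean (mirrored fits₀)) refl

-- A rainbow side has two colours that spare its end, one conflicting with x and one with z. The
-- inequalities between `p₀` and `p₁` and between `q₀` and `q₁` hold because a matching sends
-- distinct colours to distinct colours.
cleanRainbow : Pairing → Form
cleanRainbow f = ∀≢ λ px qz → ∀′ λ pa → ∀′ λ qa → ∀≢ λ p₀ p₁ → ∀≢ λ q₀ q₁ →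
  f px qz (clean pa qa) (cand false true false p₀ q₀) ∨′ f px qz (clean pa qa) (cand false false true p₁ q₁)

clean-rainbow : ⟦ cleanRainbow fits₀ ⟧
clean-rainbow = decide (cleanRainbow fits₀) refl

rainbow-clean : ⟦ cleanRainbow (mirrored fits₀) ⟧
rainbow-clean = decide (cleanRainbow (mirrored fits₀)) refl

-- A second colour on the other side replaces the assumption that `px` and `qz` differ; its flags
-- say what this colour may cost.
twoRainbow : Pairing → (end x z : Bool) → Form
twoRainbow f end x z = ∀′ λ px → ∀′ λ qz →
  ∀≢ λ p₀ p₁ → ∀≢ λ q₀ q₁ → ∀≢ λ r₀ r₁ → ∀≢ λ s₀ s₁ →
  (f px qz (clean p₀ q₀) (cand false true false r₀ s₀) ∨′ f px qz (clean p₀ q₀) (cand false false true r₁ s₁)) ∨′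
  (f px qz (cand end x z p₁ q₁) (cand false true false r₀ s₀) ∨′
   f px qz (cand end x z p₁ q₁) (cand false false true r₁ s₁))

two-rainbow : ∀ x z → x ∧ z ≡ false → ⟦ twoRainbow fits₀ false x z ⟧
two-rainbow = decide (∀ᵇ λ x → ∀ᵇ λ z → unless x ∧ z then twoRainbow fits₀ false x z) refl

rainbow-two : ∀ x z → x ∧ z ≡ false → ⟦ twoRainbow (mirrored fits₀) false x z ⟧
rainbow-two = decide (∀ᵇ λ x → ∀ᵇ λ z → unless x ∧ z then twoRainbow (mirrored fits₀) false x z) refl

end-rainbow : ⟦ twoRainbow fits₀ true false false ⟧
end-rainbow = decide (twoRainbow fits₀ true false false) refl

rainbow-end : ⟦ twoRainbow (mirrored fits₀) true false false ⟧
rainbow-end = decide (twoRainbow (mirrored fits₀) true false false) refl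

-- Three-colour covers of one gadget

-- The part of a gadget around a (with end w) or around d (with end v), once the ends, x and z are coloured:
-- the colours that conflict with those of the end, x and z, and the matchings to p and q.
record Side : Set where
  constructor side
  field
    end hitX hitZ : Color
    toP toQ : Perm
open Side

at : Side → Color → Candidate
at S a = cand (end S == a) (hitX S == a) (hitZ S == a) (toP S $ a) (toQ S $ a)

at-≡ : ∀ S a {e x z} → end S == a ≡ e → hitX S == a ≡ x → hitZ S == a ≡ z →
       at S a ≡ cand e x z (toP S $ a) (toQ S $ a)
at-≡ S a refl refl refl = refl

Clean : Side → Color → Set
Clean S a = a ≢ end S × a ≢ hitX S × a ≢ hitZ S

Rainbow : Side → Set
Rainbow S = end S ≢ hitX S × end S ≢ hitZ S × hitX S ≢ hitZ S

clean-or-rainbow : ∀ S → ∃ (Clean S) ⊎ Rainbow S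
clean-or-rainbow S = rainbow? (end S) (hitX S) (hitZ S)

at-clean : ∀ S {a} → Clean S a → at S a ≡ clean (toP S $ a) (toQ S $ a)
at-clean S (e , x , z) = at-≡ S _ (≢⇒== (≢-sym e)) (≢⇒== (≢-sym x)) (≢⇒== (≢-sym z))

at-hitX : ∀ S → Rainbow S → at S (hitX S) ≡ cand false true false (toP S $ hitX S) (toQ S $ hitX S)
at-hitX S (ex , ez , xz) = at-≡ S _ (≢⇒== ex) (==-refl (hitX S)) (≢⇒== (≢-sym xz))

at-hitZ : ∀ S → Rainbow S → at S (hitZ S) ≡ cand false false true (toP S $ hitZ S) (toQ S $ hitZ S)
at-hitZ S (ex , ez , xz) = at-≡ S _ (≢⇒== ez) (≢⇒== xz) (==-refl (hitZ S))

-- m and n bound the conflicts with the two ends.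
Solved : Pairing → (px qz : Color) (S T : Side) (m n : ℕ) → Set
Solved f px qz S T m n = ∃₂ λ a b →
  bit (end S == a) ≤ m × bit (end T == b) ≤ n × ⟦ f px qz (at S a) (at T b) ⟧

via : ∀ f px qz S T {m n a b A B} → at S a ≡ A → at T b ≡ B → bit (Candidate.fromEnd A) ≤ m → bit (Candidate.fromEnd B) ≤ n →
      ⟦ f px qz A B ⟧ → Solved f px qz S T m n
via f px qz S T {a = a} {b} refl refl h k r = a , b , h , k , r

via-two : ∀ f px qz S T {m a₀ a₁ A₀ A₁ X Z} → at S a₀ ≡ A₀ → at S a₁ ≡ A₁ →
  bit (Candidate.fromEnd A₀) ≤ m → bit (Candidate.fromEnd A₁) ≤ m →
  at T (hitX T) ≡ X → at T (hitZ T) ≡ Z → bit (Candidate.fromEnd X) ≤ 0 → bit (Candidate.fromEnd Z) ≤ 0 →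
  ⟦ (f px qz A₀ X ∨′ f px qz A₀ Z) ∨′ (f px qz A₁ X ∨′ f px qz A₁ Z) ⟧ → Solved f px qz S T m 0
via-two f px qz S T p₀ p₁ h₀ h₁ x z hx hz (inj₁ (inj₁ r)) = via f px qz S T p₀ x h₀ hx r
via-two f px qz S T p₀ p₁ h₀ h₁ x z hx hz (inj₁ (inj₂ r)) = via f px qz S T p₀ z h₀ hz r
via-two f px qz S T p₀ p₁ h₀ h₁ x z hx hz (inj₂ (inj₁ r)) = via f px qz S T p₁ x h₁ hx r
via-two f px qz S T p₀ p₁ h₀ h₁ x z hx hz (inj₂ (inj₂ r)) = via f px qz S T p₁ z h₁ hz r

-- If `px` and `qz` differ, one clean colour of `S` suffices. Otherwise the colour excluded by the
-- end is also hit by x or z, so a second colour of `S` spares the end and conflicts with at most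
-- one of x and z.
solve-clean-rainbow : ∀ f → ⟦ cleanRainbow f ⟧ → (∀ x z → x ∧ z ≡ false → ⟦ twoRainbow f false x z ⟧) →
  ∀ px qz S T → ∃ (Clean S) → Rainbow T → px ≢ qz ⊎ end S ≡ hitX S ⊎ end S ≡ hitZ S → Solved f px qz S T 0 0
solve-clean-rainbow f one two px qz S T (a₀ , cl) rb (inj₁ px≢qz)
  with one px qz (≢⇒== px≢qz) (toP S $ a₀) (toQ S $ a₀)
    (toP T $ hitX T) (toP T $ hitZ T) (≢⇒== ($-≢ (toP T) (proj₂ (proj₂ rb))))
    (toQ T $ hitX T) (toQ T $ hitZ T) (≢⇒== ($-≢ (toQ T) (proj₂ (proj₂ rb))))
... | inj₁ r = via f px qz S T (at-clean S cl) (at-hitX T rb) z≤n z≤n r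
... | inj₂ r = via f px qz S T (at-clean S cl) (at-hitZ T rb) z≤n z≤n r
solve-clean-rainbow f one two px qz S T (a₀ , cl) rb (inj₂ e) =
  let a₁ , a₁≢end , a₁≢a₀ = avoid (end S) a₀ in
  via-two f px qz S T (at-clean S cl) (at-≡ S a₁ (≢⇒== (≢-sym a₁≢end)) refl refl) z≤n z≤n (at-hitX T rb) (at-hitZ T rb) z≤n z≤n
   (two (hitX S == a₁) (hitZ S == a₁) (once e a₁≢end) px qz
    _ _ (≢⇒== ($-≢ (toP S) (≢-sym a₁≢a₀))) _ _ (≢⇒== ($-≢ (toQ S) (≢-sym a₁≢a₀)))
    _ _ (≢⇒== ($-≢ (toP T) (proj₂ (proj₂ rb)))) _ _ (≢⇒== ($-≢ (toQ T) (proj₂ (proj₂ rb)))))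
  where
  once : end S ≡ hitX S ⊎ end S ≡ hitZ S → ∀ {a} → a ≢ end S → (hitX S == a) ∧ (hitZ S == a) ≡ false
  once (inj₁ p) {a} q rewrite ≢⇒== {i = hitX S} {a} (λ r → q (trans (≡-sym r) (≡-sym p))) = refl
  once (inj₂ p) {a} q rewrite ≢⇒== {i = hitZ S} {a} (λ r → q (trans (≡-sym r) (≡-sym p))) with hitX S == a
  ... | true  = refl
  ... | false = refl

-- Here the second colour of `S` is the one excluded by its end: it costs a conflict there, but none
-- with x or z.
solve-end-rainbow : ∀ f → ⟦ twoRainbow f true false false ⟧ →
  ∀ px qz S T → ∃ (Clean S) → Rainbow T → end S ≢ hitX S → end S ≢ hitZ S → Solved f px qz S T 1 0
solve-end-rainbow f two px qz S T (a₀ , cl) rb ex ez =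
  via-two f px qz S T (at-clean S cl) (at-≡ S (end S) (==-refl (end S)) (≢⇒== (≢-sym ex)) (≢⇒== (≢-sym ez)))
    z≤n (s≤s z≤n) (at-hitX T rb) (at-hitZ T rb) z≤n z≤n
    (two px qz
     _ _ (≢⇒== ($-≢ (toP S) (proj₁ cl))) _ _ (≢⇒== ($-≢ (toQ S) (proj₁ cl)))
     _ _ (≢⇒== ($-≢ (toP T) (proj₂ (proj₂ rb)))) _ _ (≢⇒== ($-≢ (toQ T) (proj₂ (proj₂ rb)))))

-- A side is inside if the colours hit by x and z are not the one excluded by the end.
inside same : Side → Bool
inside S = not (end S == hitX S) ∧ not (end S == hitZ S)
same S = hitX S == hitZ S

-- For inside sides, not being `same` means being rainbow. So the test holds when both sides are
-- inside and either both are rainbow, or exactly one is and `px` equals `qz`.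
obstructed : (px qz : Color) (S T : Side) → Bool
obstructed px qz S T = inside S ∧ (inside T ∧ (not (same S ∧ same T) ∧ (not (same S ∨ same T) ∨ (px == qz))))

rainbow-inside : ∀ S → Rainbow S → inside S ≡ true × same S ≡ false
rainbow-inside S (ex , ez , xz) rewrite ≢⇒== ex | ≢⇒== ez = refl , ≢⇒== xz

inside-≢ : ∀ S → inside S ≡ true → end S ≢ hitX S × end S ≢ hitZ S
inside-≢ S h with end S == hitX S in p | end S == hitZ S in q
... | false | false = ==⇒≢ p , ==⇒≢ q

outside : ∀ S → inside S ≡ false → end S ≡ hitX S ⊎ end S ≡ hitZ S
outside S h with end S F.≟ hitX S | end S F.≟ hitZ S
... | yes p | _     = inj₁ p
... | no _  | yes q = inj₂ q
... | no p  | no q  = ⊥-elim (true≢false (cong₂ (λ x y → not x ∧ not y) (≢⇒== p) (≢⇒== q)) h)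

private
  exit : ∀ (px qz : Color) S → (px ≡ qz → inside S ≡ false) → px ≢ qz ⊎ end S ≡ hitX S ⊎ end S ≡ hitZ S
  exit px qz S h with px F.≟ qz
  ... | no p  = inj₁ p
  ... | yes p = inj₂ (outside S (h p))

  bool : ∀ b c → b ∧ (not (c ∧ false) ∧ (not (c ∨ false) ∨ true)) ≡ false → b ≡ false
  bool false c     _ = refl
  bool true  false ()
  bool true  true  ()

  bool′ : ∀ b c → b ∧ (not c ∨ true) ≡ false → b ≡ false
  bool′ false c     _ = refl
  bool′ true  false ()
  bool′ true  true  ()

  clashS : ∀ px qz S T → obstructed px qz S T ≡ false → Rainbow T → px ≡ qz → inside S ≡ false
  clashS px .px S T h t refl
    rewrite proj₁ (rainbow-inside T t) | proj₂ (rainbow-inside T t) | ==-refl px = bool (inside S) (same S) h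

  clashT : ∀ px qz S T → obstructed px qz S T ≡ false → Rainbow S → px ≡ qz → inside T ≡ false
  clashT px .px S T h s refl
    rewrite proj₁ (rainbow-inside S s) | proj₂ (rainbow-inside S s) | ==-refl px = bool′ (inside T) (same T) h

  unobstructed : ∀ px qz S T → obstructed px qz S T ≡ false → Rainbow S → Rainbow T → ⊥
  unobstructed px qz S T h s t
    rewrite proj₁ (rainbow-inside S s) | proj₂ (rainbow-inside S s)
          | proj₁ (rainbow-inside T t) | proj₂ (rainbow-inside T t) with h
  ... | ()

-- Two rainbow sides would be an obstruction. If just one side is rainbow, then either `px` and `qz`
-- differ or the other side is not inside, which are the two ways out offered by
-- `solve-clean-rainbow`.
unobstructed-solved : ∀ px qz S T → obstructed px qz S T ≡ false → Solved fits₀ px qz S T 0 0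
unobstructed-solved px qz S T h with clean-or-rainbow S | clean-or-rainbow T
... | inj₁ (a , s) | inj₁ (b , t) = via fits₀ px qz S T (at-clean S s) (at-clean T t) z≤n z≤n
  (clean-clean false false refl px qz (toP S $ a) (toQ S $ a) (toP T $ b) (toQ T $ b))
... | inj₁ s | inj₂ t =
  solve-clean-rainbow fits₀ clean-rainbow two-rainbow px qz S T s t (exit px qz S (clashS px qz S T h t))
... | inj₂ s | inj₁ t =
  let b , a , h , k , r = solve-clean-rainbow (mirrored fits₀) rainbow-clean rainbow-two px qz T S t s
                    (exit px qz T (clashT px qz S T h s))
  in a , b , k , h , r
... | inj₂ s | inj₂ t = ⊥-elim (unobstructed px qz S T h s t)

-- The colours are named so that conflicts along the spanning forest wx, wz, wa, vd, zq, qp are equalities.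
-- A permutation along another edge sends each colour to the one that it conflicts with.
record Gadget : Set where
  field
    vx vz xa za xd zd xp ap dp aq dq : Perm
open Gadget

wSide vSide : Gadget → (end x z : Color) → Side
wSide g c x z = side c (xa g $ x) (za g $ z) (ap g) (aq g)
vSide g j x z = side j (xd g $ x) (zd g $ z) (dp g) (dq g)

validColors : Gadget → (c j x z a d p q : Color) → Bool
validColors g c j x z a d p q =
  valid (c == x) (vx g $ j == x) (c == z) (vz g $ j == z) (c == a) (j == d)
    (xa g $ x == a) (za g $ z == a) (xd g $ x == d) (zd g $ z == d)
    (xp g $ x == p) (z == q) (ap g $ a == p) (dp g $ d == p) (aq g $ a == q) (dq g $ d == q) (q == p)

-- The colours c of w and j of v extend to g with at most m conflicts at w and n at v.
record Extension (g : Gadget) (c j : Color) (m n : ℕ) : Set where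
  constructor extension
  field
    x z a d p q : Color
    ok  : validColors g c j x z a d p q ≡ true
    atW : bit (c == x) + (bit (c == z) + (bit (c == a) + 0)) ≤ m
    atV : bit (vx g $ j == x) + (bit (vz g $ j == z) + (bit (j == d) + 0)) ≤ n

extend : ∀ g c j x z a d {wx vx′ wz vz′ m n} →
  c == x ≡ wx → vx g $ j == x ≡ vx′ → c == z ≡ wz → vz g $ j == z ≡ vz′ →
  ⟦ fits wx vx′ wz vz′ (xp g $ x) z (at (wSide g c x z) a) (at (vSide g j x z) d) ⟧ →
  bit wx + (bit wz + (bit (c == a) + 0)) ≤ m → bit vx′ + (bit vz′ + (bit (j == d) + 0)) ≤ n →
  Extension g c j m n
extend g c j x z a d refl refl refl refl (p , q , ok) = extension x z a d p q ok

weaken : ∀ {g c j m n m′ n′} → m ≤ m′ → n ≤ n′ → Extension g c j m n → Extension g c j m′ n′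
weaken h k (extension x z a d p q ok w v) = extension x z a d p q ok (ℕₚ.≤-trans w h) (ℕₚ.≤-trans v k)

obstruction : Gadget → (c j x z : Color) → Bool
obstruction g c j x z = obstructed (xp g $ x) z (wSide g c x z) (vSide g j x z)

+0-≤ : ∀ {k m} → k ≤ m → k + 0 ≤ m
+0-≤ {k} h = subst (_≤ _) (≡-sym (ℕₚ.+-identityʳ k)) h

unobstructed-extension : ∀ g c j x z → c ≢ x → vx g $ j ≢ x → c ≢ z → vz g $ j ≢ z →
  obstruction g c j x z ≡ false → Extension g c j 0 0
unobstructed-extension g c j x z wx vx′ wz vz′ h =
  let a , d , k , l , r = unobstructed-solved (xp g $ x) z (wSide g c x z) (vSide g j x z) h in
  extend g c j x z a d (≢⇒== wx) (≢⇒== vx′) (≢⇒== wz) (≢⇒== vz′) r (+0-≤ k) (+0-≤ l)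

third : Color → Color → Color
third x y = proj₁ (avoid x y)

third-≢ˡ : ∀ x y → x ≢ third x y
third-≢ˡ x y = ≢-sym (proj₁ (proj₂ (avoid x y)))

third-≢ʳ : ∀ x y → y ≢ third x y
third-≢ʳ x y = ≢-sym (proj₂ (proj₂ (avoid x y)))

clear : Bool → Bool → Form
clear b b′ = ⟨ not b ⟩ ∨′ ⟨ not b′ ⟩

-- Two available colours of x (or of z) cannot both be obstructed.
two-x : ∀ c az j dz qz ax ax′ → ax == ax′ ≡ false → ∀ dx dx′ → dx == dx′ ≡ false → ∀ px px′ → px == px′ ≡ false →
  ⟦ clear (obstructed px qz (side c ax az zero zero) (side j dx dz zero zero))
          (obstructed px′ qz (side c ax′ az zero zero) (side j dx′ dz zero zero)) ⟧
two-x = decide (∀′ λ c → ∀′ λ az → ∀′ λ j → ∀′ λ dz → ∀′ λ qz → ∀≢ λ ax ax′ → ∀≢ λ dx dx′ → ∀≢ λ px px′ →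
  clear (obstructed px qz (side c ax az zero zero) (side j dx dz zero zero))
        (obstructed px′ qz (side c ax′ az zero zero) (side j dx′ dz zero zero))) refl

two-z : ∀ c ax j dx px az az′ → az == az′ ≡ false → ∀ dz dz′ → dz == dz′ ≡ false → ∀ qz qz′ → qz == qz′ ≡ false →
  ⟦ clear (obstructed px qz (side c ax az zero zero) (side j dx dz zero zero))
          (obstructed px qz′ (side c ax az′ zero zero) (side j dx dz′ zero zero)) ⟧
two-z = decide (∀′ λ c → ∀′ λ ax → ∀′ λ j → ∀′ λ dx → ∀′ λ px → ∀≢ λ az az′ → ∀≢ λ dz dz′ → ∀≢ λ qz qz′ →
  clear (obstructed px qz (side c ax az zero zero) (side j dx dz zero zero))
        (obstructed px qz′ (side c ax az′ zero zero) (side j dx dz′ zero zero))) refl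

-- If the ends exclude the same colour of x, or of z, two colours remain for it and one of them is
-- unobstructed. So a pair can be bad only if the colours of x and z are both forced, and `third` is
-- then the forced colour.
bad : Gadget → (c j : Color) → Bool
bad g c j = not (vx g $ j == c) ∧ (not (vz g $ j == c) ∧
  obstruction g c j (third c (vx g $ j)) (third c (vz g $ j)))

-- When the ends agree on x or on z, both remaining colours are tried, and `two-x` or `two-z` shows
-- that one of them succeeds. Otherwise not being bad is the absence of an obstruction.
good-extension : ∀ g c j → bad g c j ≡ false → Extension g c j 0 0
good-extension g c j h with vx g $ j F.≟ c | vz g $ j F.≟ c
... | yes p | _ =
  let x = third c c ; x′ = third c x ; z = third c (vz g $ j)
      try = λ x c≢x → unobstructed-extension g c j x z c≢x (λ q → c≢x (trans (≡-sym p) q)) (third-≢ˡ c _) (third-≢ʳ c _)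
      x≢x′ = third-≢ʳ c x
  in [ (λ q → try x (third-≢ˡ c c) (not-true q)) , (λ q → try x′ (third-≢ˡ c x) (not-true q)) ]′
       (two-x c (za g $ z) j (zd g $ z) z (xa g $ x) (xa g $ x′) (≢⇒== ($-≢ (xa g) x≢x′))
         (xd g $ x) (xd g $ x′) (≢⇒== ($-≢ (xd g) x≢x′)) (xp g $ x) (xp g $ x′) (≢⇒== ($-≢ (xp g) x≢x′)))
... | no _ | yes p =
  let z = third c c ; z′ = third c z ; x = third c (vx g $ j)
      try = λ z c≢z → unobstructed-extension g c j x z (third-≢ˡ c _) (third-≢ʳ c _) c≢z (λ q → c≢z (trans (≡-sym p) q))
      z≢z′ = third-≢ʳ c z
  in [ (λ q → try z (third-≢ˡ c c) (not-true q)) , (λ q → try z′ (third-≢ˡ c z) (not-true q)) ]′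
       (two-z c (xa g $ x) j (xd g $ x) (xp g $ x) (za g $ z) (za g $ z′) (≢⇒== ($-≢ (za g) z≢z′))
         (zd g $ z) (zd g $ z′) (≢⇒== ($-≢ (zd g) z≢z′)) z z′ (≢⇒== z≢z′))
... | no p | no q = unobstructed-extension g c j _ _ (third-≢ˡ c _) (third-≢ʳ c _) (third-≢ˡ c _) (third-≢ʳ c _)
  (trans (cong₂ (λ b b′ → not b ∧ (not b′ ∧ obstruction g c j (third c (vx g $ j)) (third c (vz g $ j))))
     (≡-sym (≢⇒== p)) (≡-sym (≢⇒== q))) h)

split-bad : ∀ g c j → bad g c j ≡ true → vx g $ j ≢ c × vz g $ j ≢ c ×
  obstruction g c j (third c (vx g $ j)) (third c (vz g $ j)) ≡ true
split-bad g c j h with vx g $ j == c in p | vz g $ j == c in q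
... | false | false = ==⇒≢ p , ==⇒≢ q , h

split-obstructed : ∀ px qz S T → obstructed px qz S T ≡ true →
  inside S ≡ true × inside T ≡ true × (same S ≡ false ⊎ same T ≡ false)
split-obstructed px qz S T h with inside S | inside T | same S | same T
... | true | true | false | _     = refl , refl , inj₁ refl
... | true | true | true  | false = refl , refl , inj₂ refl

not-same-rainbow : ∀ S → inside S ≡ true → same S ≡ false → Rainbow S
not-same-rainbow S h k = let p , q = inside-≢ S h in p , q , ==⇒≢ k

same-clean : ∀ S → same S ≡ true → ∃ (Clean S)
same-clean S h = let e , p , q = avoid (end S) (hitX S) in e , p , q , subst (e ≢_) (==-sound h) q

end-with-clean : ∀ f → ⟦ endClean f ⟧ → ∀ px qz S T → inside S ≡ true → ∃ (Clean T) → Solved f px qz S T 1 0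
end-with-clean f form px qz S T h (b , t) =
  let p , q = inside-≢ S h in
  via f px qz S T (at-≡ S (end S) (==-refl (end S)) (≢⇒== (≢-sym p)) (≢⇒== (≢-sym q))) (at-clean T t) (s≤s z≤n) z≤n
    (form px qz (toP S $ end S) (toQ S $ end S) (toP T $ b) (toQ T $ b))

-- A conflict at the end of `S` makes the excluded colour of `S` usable. It goes with a clean colour
-- of `T` if there is one; otherwise `T` is rainbow, `S` is `same`, and `S` has a clean colour as an
-- alternative.
absorb-solve : ∀ f → ⟦ endClean f ⟧ → ⟦ twoRainbow f true false false ⟧ → ∀ px qz S T →
  inside S ≡ true → inside T ≡ true → same S ≡ true ⊎ same T ≡ true →
  Solved f px qz S T 1 0
absorb-solve f ec tr px qz S T hS hT _ with clean-or-rainbow T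
... | inj₁ t = end-with-clean f ec px qz S T hS t
absorb-solve f ec tr px qz S T hS hT (inj₁ s) | inj₂ t =
  let p , q = inside-≢ S hS in solve-end-rainbow f tr px qz S T (same-clean S s) t p q
absorb-solve f ec tr px qz S T hS hT (inj₂ s) | inj₂ (_ , _ , r) = ⊥-elim (r (==-sound s))

private
  swap-Solved : ∀ {px qz S T m n} → Solved (mirrored fits₀) px qz S T m n → Solved fits₀ px qz T S n m
  swap-Solved (a , b , h , k , r) = b , a , k , h , r

  extend-solved : ∀ g c j x z → c ≢ x → vx g $ j ≢ x → c ≢ z → vz g $ j ≢ z → ∀ {m n} →
    Solved fits₀ (xp g $ x) z (wSide g c x z) (vSide g j x z) m n → Extension g c j m n
  extend-solved g c j x z wx vx′ wz vz′ (a , d , k , l , r) =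
    extend g c j x z a d (≢⇒== wx) (≢⇒== vx′) (≢⇒== wz) (≢⇒== vz′) r (+0-≤ k) (+0-≤ l)

-- Both sides rainbow at x: recolour x with a colour y hit by an end; then the old hits of x become clean.
recolour : ∀ g c j x y z → x ≢ y → c ≢ z → vz g $ j ≢ z →
  Rainbow (wSide g c x z) → Rainbow (vSide g j x z) →
  (c == y) ∧ (vx g $ j == y) ≡ false → Extension g c j (bit (c == y)) (bit (vx g $ j == y))
recolour g c j x y z x≢y wz vz′ (s₁ , s₂ , s₃) (t₁ , t₂ , t₃) h =
  let S = wSide g c y z ; T = vSide g j y z
      a = xa g $ x ; d = xd g $ x
      r = clean-clean (c == y) (vx g $ j == y) h (xp g $ y) z (ap g $ a) (aq g $ a) (dp g $ d) (dq g $ d)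
  in extend g c j y z a d refl refl (≢⇒== wz) (≢⇒== vz′)
       (subst₂ (λ A D → ⟦ fits (c == y) (vx g $ j == y) false false (xp g $ y) z A D ⟧)
         (≡-sym (at-clean S {a} (≢-sym s₁ , $-≢ (xa g) x≢y , s₃)))
         (≡-sym (at-clean T {d} (≢-sym t₁ , $-≢ (xd g) x≢y , t₃))) r)
       (tight (c == y) s₁) (tight (vx g $ j == y) t₁)
  where
  tight : ∀ {u v : Color} b → u ≢ v → bit b + (0 + (bit (u == v) + 0)) ≤ bit b
  tight b p rewrite ≢⇒== p = ℕₚ.≤-reflexive (ℕₚ.+-identityʳ (bit b))

-- For a bad pair both sides are inside and at least one is rainbow. If both are, x takes the colour
-- excluded by the end that is to bear the conflict. If only one is, `absorb-solve` applies in
-- either direction, and the conflict is that of a with w or of d with v.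
extension-at : ∀ g c j → Extension g c j 1 0 × Extension g c j 0 1
extension-at g c j with bad g c j in eq
... | false = weaken z≤n z≤n e , weaken z≤n z≤n e
  where e = good-extension g c j eq
... | true =
  let p , q , o = split-bad g c j eq
      x = third c (vx g $ j) ; z = third c (vz g $ j)
      S = wSide g c x z ; T = vSide g j x z
      i , k , l = split-obstructed (xp g $ x) z S T o
  in cases p q x z (third-≢ˡ c _) (third-≢ʳ c _) (third-≢ˡ c _) (third-≢ʳ c _) i k l
  where
  cases : vx g $ j ≢ c → vz g $ j ≢ c → ∀ x z → c ≢ x → vx g $ j ≢ x → c ≢ z → vz g $ j ≢ z →
    let S = wSide g c x z ; T = vSide g j x z in
    inside S ≡ true → inside T ≡ true → same S ≡ false ⊎ same T ≡ false → Extension g c j 1 0 × Extension g c j 0 1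
  cases p q x z cx vx′ cz vz′ i k l with same (wSide g c x z) in s | same (vSide g j x z) in t
  ... | false | false =
    let rs = not-same-rainbow (wSide g c x z) i s ; rt = not-same-rainbow (vSide g j x z) k t in
    subst₂ (Extension g c j) (cong bit (==-refl c)) (cong bit (≢⇒== p))
      (recolour g c j x c z (≢-sym cx) cz vz′ rs rt (cong₂ _∧_ (==-refl c) (≢⇒== p))) ,
    subst₂ (Extension g c j) (cong bit (≢⇒== (≢-sym p))) (cong bit (==-refl (vx g $ j)))
      (recolour g c j x (vx g $ j) z (≢-sym vx′) cz vz′ rs rt (cong₂ _∧_ (≢⇒== (≢-sym p)) (==-refl (vx g $ j))))
  ... | true | true = ⊥-elim (absurd l)
    where
    absurd : true ≡ false ⊎ true ≡ false → ⊥
    absurd (inj₁ ())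
    absurd (inj₂ ())
  ... | true | false =
    let S = wSide g c x z ; T = vSide g j x z in
    extend-solved g c j x z cx vx′ cz vz′ (absorb-solve fits₀ end-clean end-rainbow (xp g $ x) z S T i k (inj₁ s)) ,
    extend-solved g c j x z cx vx′ cz vz′
      (swap-Solved {xp g $ x} {z} {T} {S} (absorb-solve (mirrored fits₀) clean-end rainbow-end (xp g $ x) z T S k i (inj₂ s)))
  ... | false | true =
    let S = wSide g c x z ; T = vSide g j x z in
    extend-solved g c j x z cx vx′ cz vz′ (absorb-solve fits₀ end-clean end-rainbow (xp g $ x) z S T i k (inj₂ t)) ,
    extend-solved g c j x z cx vx′ cz vz′
      (swap-Solved {xp g $ x} {z} {T} {S} (absorb-solve (mirrored fits₀) clean-end rainbow-end (xp g $ x) z T S k i (inj₁ t)))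

-- Counting the bad pairs of a gadget

sum-mono : ∀ {n} {f g : Fin n → ℕ} → (∀ i → f i ≤ g i) → sum f ≤ sum g
sum-mono {zero}  h = z≤n
sum-mono {suc n} h = ℕₚ.+-mono-≤ (h zero) (sum-mono (λ i → h (suc i)))

total : (Color → Color → Bool) → ℕ
total f = sum λ j → sum λ c → bit (f c j)

-- Parts of bad that look at fewer permutations; they prune the enumeration below.
suspect : (vx vz xa xd : Perm) (c j : Color) → Bool
suspect vx vz xa xd c j =
  not (vx $ j == c) ∧ (not (vz $ j == c) ∧ (not (c == xa $ x) ∧ not (j == xd $ x)))
  where x = third c (vx $ j)

suspect′ : (vx vz xa xd za : Perm) (c j : Color) → Bool
suspect′ vx vz xa xd za c j = suspect vx vz xa xd c j ∧ not (c == za $ third c (vz $ j))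

fewBad′ : (vx vz xa xd za : Perm) → Form
fewBad′ vx vz xa xd za = ⟨ total (suspect′ vx vz xa xd za) ≤ᵇ 3 ⟩ ∨′ (∀′ λ zd → ∀′ λ xp →
  ⟨ total (bad (record { vx = vx ; vz = vz ; xa = xa ; za = za ; xd = xd ; zd = zd ; xp = xp
                       -- `bad` does not look at the matchings from a and d to p and q, so any
                       -- values stand for all of them.
                       ; ap = zero ; dp = zero ; aq = zero ; dq = zero })) ≤ᵇ 3 ⟩)

fewBad : (vx vz xa xd : Perm) → Form
fewBad vx vz xa xd = ⟨ total (suspect vx vz xa xd) ≤ᵇ 3 ⟩ ∨′ (∀′ λ za → fewBad′ vx vz xa xd za)

-- Since `suspect` and `suspect′` bound `bad` from above, the seven permutations that `bad` reads
-- are all enumerated only where both bounds exceed 3.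
few-bad : ∀ vx vz xa xd → ⟦ fewBad vx vz xa xd ⟧
few-bad = decide (∀′ λ vx → ∀′ λ vz → ∀′ λ xa → ∀′ λ xd → fewBad vx vz xa xd) refl

≤ᵇ-true : ∀ {m n} → (m ≤ᵇ n) ≡ true → m ≤ n
≤ᵇ-true {m} {n} h = ℕₚ.≤ᵇ⇒≤ m n (subst T (≡-sym h) _)

bad-suspect : ∀ g c j → bit (bad g c j) ≤ bit (suspect′ (vx g) (vz g) (xa g) (xd g) (za g) c j)
bad-suspect g c j = forget (vx g $ j == c) (vz g $ j == c) (c == xa g $ x) (c == za g $ z) (j == xd g $ x) (j == zd g $ z) _
  where
  x = third c (vx g $ j)
  z = third c (vz g $ j)
  forget : ∀ v w cx cz dx dz r →
    bit (not v ∧ (not w ∧ ((not cx ∧ not cz) ∧ ((not dx ∧ not dz) ∧ r)))) ≤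
    bit ((not v ∧ (not w ∧ (not cx ∧ not dx))) ∧ not cz)
  forget true  _     _     _     _     _     _     = z≤n
  forget false true  _     _     _     _     _     = z≤n
  forget false false true  _     _     _     _     = z≤n
  forget false false false true  _     _     _     = z≤n
  forget false false false false true  _     _     = z≤n
  forget false false false false false true  _     = z≤n
  forget false false false false false false true  = s≤s z≤n
  forget false false false false false false false = z≤n

bit-∧ˡ : ∀ b c → bit (b ∧ c) ≤ bit b
bit-∧ˡ true  true  = s≤s z≤n
bit-∧ˡ true  false = z≤n
bit-∧ˡ false _     = z≤n

total-mono : ∀ {f g} → (∀ c j → bit (f c j) ≤ bit (g c j)) → total f ≤ total g
total-mono h = sum-mono λ j → sum-mono λ c → h c j

bad-≤3 : ∀ g → total (bad g) ≤ 3
bad-≤3 g = conclude (few-bad (vx g) (vz g) (xa g) (xd g))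
  where
  f₁ f₂ : Color → Color → Bool
  f₁ = suspect (vx g) (vz g) (xa g) (xd g)
  f₂ = suspect′ (vx g) (vz g) (xa g) (xd g) (za g)
  conclude′ : ⟦ fewBad′ (vx g) (vz g) (xa g) (xd g) (za g) ⟧ → total (bad g) ≤ 3
  conclude′ (inj₁ k) = ℕₚ.≤-trans (total-mono {bad g} {f₂} (bad-suspect g)) (≤ᵇ-true {total f₂} k)
  conclude′ (inj₂ k) = ≤ᵇ-true {total (bad g)} (k (zd g) (xp g))
  conclude : ⟦ fewBad (vx g) (vz g) (xa g) (xd g) ⟧ → total (bad g) ≤ 3
  conclude (inj₁ h) = ℕₚ.≤-trans (total-mono {bad g} {f₁} λ c j →
    ℕₚ.≤-trans (bad-suspect g c j) (bit-∧ˡ (f₁ c j) (not (c == za g $ third c (vz g $ j))))) (≤ᵇ-true {total f₁} h)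
  conclude (inj₂ h) = conclude′ (h (za g))

-- Blocks

-- e matches the colours of the base with those of the hub; the base has colour j and at most m conflicts.
record Block (e : Perm) (gs : Fin 3 → Gadget) (j : Color) (m : ℕ) : Set where
  constructor block
  field
    c         : Color
    inW inV   : Fin 3 → ℕ
    extended  : ∀ k → Extension (gs k) c j (inW k) (inV k)
    atW       : bit (e $ j == c) + sum inW ≤ 1
    atV       : bit (e $ j == c) + sum inV ≤ m

table : Bool → Bool → Bool → Fin 3 → Bool
table b₀ b₁ b₂ zero             = b₀
table b₀ b₁ b₂ (suc zero)       = b₁
table b₀ b₁ b₂ (suc (suc zero)) = b₂

count₃ : (Fin 3 → Bool) → ℕ
count₃ b = sum (λ k → bit (b k))

Share : (Fin 3 → Bool) → Form
Share b = (∃′ λ f → ⟨ (count₃ (λ k → b k ∧ (k == f)) ≤ᵇ 1) ∧ (count₃ (λ k → b k ∧ not (k == f)) ≤ᵇ 1) ⟩)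
  ∨′ ⟨ b zero ∧ (b (suc zero) ∧ b (suc (suc zero))) ⟩

shared : ∀ b₀ b₁ b₂ → ⟦ Share (table b₀ b₁ b₂) ⟧
shared = decide (∀ᵇ λ b₀ → ∀ᵇ λ b₁ → ∀ᵇ λ b₂ → Share (table b₀ b₁ b₂)) refl

-- Up to two bad gadgets can be shared out, one to the hub and one to the base: `f` is the gadget
-- that the hub takes. Three cannot.
split-load : ∀ (b : Fin 3 → Bool) →
  (∃ λ f → count₃ (λ k → b k ∧ (k == f)) ≤ 1 × count₃ (λ k → b k ∧ not (k == f)) ≤ 1) ⊎ (∀ k → b k ≡ true)
split-load b = conclude (shared (b zero) (b (suc zero)) (b (suc (suc zero))))
  where
  conclude : ⟦ Share (table (b zero) (b (suc zero)) (b (suc (suc zero)))) ⟧ → _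
  conclude (inj₁ (f , t)) = inj₁ (f , ≤ᵇ-true {count₃ λ k → b k ∧ (k == f)} (proj₁ both)
                                    , ≤ᵇ-true {count₃ λ k → b k ∧ not (k == f)} (proj₂ both))
    where both = ∧-split {count₃ (λ k → b k ∧ (k == f)) ≤ᵇ 1} t
  conclude (inj₂ t) = inj₂ λ where
    zero             → proj₁ (∧-split {b zero} t)
    (suc zero)       → proj₁ (∧-split {b (suc zero)} (proj₂ (∧-split {b zero} t)))
    (suc (suc zero)) → proj₂ (∧-split {b (suc zero)} (proj₂ (∧-split {b zero} t)))

exhausted : ∀ {x y z w : Color} → x ≢ y → x ≢ z → y ≢ z → w ≢ y → w ≢ z → w ≡ x
exhausted {x} {y} {z} {w} p q r s t = ==-sound (covers x y (≢⇒== p) z (≢⇒== q) (≢⇒== r) w (≢⇒== s) (≢⇒== t))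
  where
  covers = decide (∀≢ λ x y → ∀′ λ z → unless x == z then unless y == z then ∀′ λ w →
    unless w == y then unless w == z then ⟨ w == x ⟩) refl

two-≤-sum : ∀ (f : Color → ℕ) {x y} → x ≢ y → f x + f y ≤ sum f
two-≤-sum f {zero} {zero} p = ⊥-elim (p refl)
two-≤-sum f {zero} {suc zero} p = ℕₚ.+-monoʳ-≤ (f zero) (ℕₚ.m≤m+n (f (suc zero)) _)
two-≤-sum f {zero} {suc (suc zero)} p = ℕₚ.+-monoʳ-≤ (f zero) (ℕₚ.≤-trans (ℕₚ.m≤m+n (f (suc (suc zero))) 0) (ℕₚ.m≤n+m _ (f (suc zero))))
two-≤-sum f {suc zero} {suc (suc zero)} p =
  ℕₚ.≤-trans (ℕₚ.+-monoʳ-≤ (f (suc zero)) (ℕₚ.m≤m+n _ 0)) (ℕₚ.m≤n+m _ (f zero))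
two-≤-sum f {suc zero} {suc zero} p = ⊥-elim (p refl)
two-≤-sum f {suc (suc zero)} {suc (suc zero)} p = ⊥-elim (p refl)
two-≤-sum f {suc zero} {zero} p = subst (_≤ sum f) (ℕₚ.+-comm (f zero) _) (two-≤-sum f {zero} {suc zero} λ ())
two-≤-sum f {suc (suc zero)} {zero} p = subst (_≤ sum f) (ℕₚ.+-comm (f zero) _) (two-≤-sum f {zero} {suc (suc zero)} λ ())
two-≤-sum f {suc (suc zero)} {suc zero} p =
  subst (_≤ sum f) (ℕₚ.+-comm (f (suc zero)) _) (two-≤-sum f {suc zero} {suc (suc zero)} λ ())

module _ (e : Perm) (gs : Fin 3 → Gadget) where

  load : Color → Color → ℕ
  load c j = count₃ λ k → bad (gs k) c j

  -- Every bad gadget is charged to w or, when the flag is unset, to the base.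
  charge : ∀ c j k (b : Bool) → Extension (gs k) c j (bit (bad (gs k) c j ∧ b)) (bit (bad (gs k) c j ∧ not b))
  charge c j k b with bad (gs k) c j in eq
  ... | false = good-extension (gs k) c j eq
  charge c j k true  | true = proj₁ (extension-at (gs k) c j)
  charge c j k false | true = proj₂ (extension-at (gs k) c j)

  -- The hub absorbs the only possible bad gadget, so the base has no conflict.
  light : ∀ c j → e $ j ≢ c → load c j ≤ 1 → Block e gs j 0
  light c j h l = block c (λ k → bit (bad (gs k) c j)) (λ _ → 0)
    (λ k → subst₂ (Extension (gs k) c j) (cong bit (∧-identityʳ _)) (cong bit (∧-zeroʳ _)) (charge c j k true))
    (subst (λ b → bit b + load c j ≤ 1) (≡-sym (≢⇒== h)) l)
    (subst (λ b → bit b + 0 ≤ 0) (≡-sym (≢⇒== h)) z≤n)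

  heavy : ∀ c j → e $ j ≢ c → Block e gs j 1 ⊎ (∀ k → bad (gs k) c j ≡ true)
  heavy c j h with split-load (λ k → bad (gs k) c j)
  ... | inj₂ t = inj₂ t
  ... | inj₁ (f , u , v) = inj₁ (block c _ _ (λ k → charge c j k (k == f))
    (subst (λ b → bit b + count₃ (λ k → bad (gs k) c j ∧ (k == f)) ≤ 1) (≡-sym (≢⇒== h)) u)
    (subst (λ b → bit b + count₃ (λ k → bad (gs k) c j ∧ not (k == f)) ≤ 1) (≡-sym (≢⇒== h)) v))

  -- If all gadgets are bad at both colours of w that do not conflict with j, then none is at the third.
  any-base-colour : ∀ j → Block e gs j 1
  any-base-colour j = go (heavy c₁ j (third-≢ˡ _ _)) (heavy c₂ j (third-≢ˡ _ _))
    where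
    c₀ = e $ j
    c₁ = third c₀ c₀
    c₂ = third c₀ c₁
    go : Block e gs j 1 ⊎ (∀ k → bad (gs k) c₁ j ≡ true) → Block e gs j 1 ⊎ (∀ k → bad (gs k) c₂ j ≡ true) → Block e gs j 1
    go (inj₁ b) _ = b
    go (inj₂ _) (inj₁ b) = b
    go (inj₂ h) (inj₂ h′) = block c₀ (λ _ → 0) (λ _ → 0) (λ k → good-extension (gs k) c₀ j (good k))
      (ℕₚ.≤-reflexive (cong (λ b → bit b + 0) (==-refl c₀))) (ℕₚ.≤-reflexive (cong (λ b → bit b + 0) (==-refl c₀)))
      where
      good : ∀ k → bad (gs k) c₀ j ≡ false
      good k with bad (gs k) c₀ j in eq
      ... | false = refl
      ... | true  = ⊥-elim (proj₁ (split-bad (gs k) c₀ j eq)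
        (exhausted (third-≢ˡ c₀ c₀) (third-≢ˡ c₀ c₁) (third-≢ʳ c₀ c₁)
          (proj₁ (split-bad (gs k) c₁ j (h k))) (proj₁ (split-bad (gs k) c₂ j (h′ k)))))

  total-load : sum (λ j → sum λ c → load c j) ≤ 9
  total-load = subst (_≤ 9) exchange (sum-mono λ k → bad-≤3 (gs k))
    where
    exchange : sum (λ k → total (bad (gs k))) ≡ sum (λ j → sum λ c → load c j)
    exchange = trans (∑-comm λ k j → sum λ c → bit (bad (gs k) c j))
      (sum-cong-≋ λ j → ∑-comm λ k c → bit (bad (gs k) c j))

  Light : Color → Set
  Light j = Block e gs j 0

  -- Two hub colours do not conflict with `j`. If neither is light, each has load at least 2.
  light? : ∀ j → Light j ⊎ 4 ≤ sum (λ c → load c j)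
  light? j with load (third (e $ j) (e $ j)) j ℕₚ.≤? 1 | load (third (e $ j) (third (e $ j) (e $ j))) j ℕₚ.≤? 1
  ... | yes l | _     = inj₁ (light _ j (third-≢ˡ _ _) l)
  ... | no _  | yes l = inj₁ (light _ j (third-≢ˡ _ _) l)
  ... | no h  | no h′ = inj₂ (ℕₚ.≤-trans (ℕₚ.+-mono-≤ (ℕₚ.≰⇒> h) (ℕₚ.≰⇒> h′))
                          (two-≤-sum (λ c → load c j) (third-≢ʳ (e $ j) _)))

  some-light : ∃ Light
  some-light with light? zero | light? (suc zero) | light? (suc (suc zero))
  ... | inj₁ l | _ | _ = _ , l
  ... | inj₂ _ | inj₁ l | _ = _ , l
  ... | inj₂ _ | inj₂ _ | inj₁ l = _ , l
  -- Three base colours of load at least 4 would give 12, against the bound 9 of `total-load`.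
  ... | inj₂ a | inj₂ b | inj₂ c = ⊥-elim (ℕₚ.<⇒≱ (ℕₚ.m≤m+n 10 2)
        (ℕₚ.≤-trans (ℕₚ.+-mono-≤ a (ℕₚ.+-mono-≤ b (ℕₚ.+-mono-≤ c z≤n))) total-load))

  abstract
    -- The bound is 0 at the safe colour and 1 elsewhere, written as a summand that can be added to
    -- the number of conflicts in K₄.
    safe-colour : ∃ λ s → ∀ j → Block e gs j (bit (not (j == s)))
    safe-colour with some-light
    ... | s , l = s , λ j → pick j
      where
      pick : ∀ j → Block e gs j (bit (not (j == s)))
      pick j with j == s in eq
      ... | true  = subst Light (≡-sym (==-sound eq)) l
      ... | false = any-base-colour j

-- The graph

==-sym : ∀ {n} (i j : Fin n) → i == j ≡ j == i
==-sym zero    zero    = refl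
==-sym zero    (suc j) = refl
==-sym (suc i) zero    = refl
==-sym (suc i) (suc j) = ==-sym i j

find : ∀ {n} → (Fin n → Bool) → Maybe (Fin n)
find {zero}  f = nothing
find {suc n} f with f zero
... | true  = just zero
... | false with find (λ i → f (suc i))
...   | just i  = just (suc i)
...   | nothing = nothing

find-sound : ∀ {n} (f : Fin n → Bool) {i} → find f ≡ just i → f i ≡ true
find-sound {suc n} f p with f zero in eq
find-sound {suc n} f refl | true = eq
... | false with find (λ i → f (suc i)) in eq′
find-sound {suc n} f refl | false | just i = find-sound (λ i → f (suc i)) eq′

-- The vertices of a gadget; W is the hub of its block and V the base.
pattern W = zero
pattern V = suc zero
pattern X = suc (suc zero)
pattern Z = suc (suc (suc zero))
pattern A′ = suc (suc (suc (suc zero)))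
pattern D′ = suc (suc (suc (suc (suc zero))))
pattern P = suc (suc (suc (suc (suc (suc zero)))))
pattern Q = suc (suc (suc (suc (suc (suc (suc zero))))))

-- The order is that of the arguments of `valid`, and each pair is oriented as its matching is read.
links : Vec (Fin 8 × Fin 8) 17
links = (W , X) ∷ (V , X) ∷ (W , Z) ∷ (V , Z) ∷ (W , A′) ∷ (V , D′) ∷ (X , A′) ∷ (Z , A′) ∷ (X , D′) ∷ (Z , D′) ∷
        (X , P) ∷ (Z , Q) ∷ (A′ , P) ∷ (D′ , P) ∷ (A′ , Q) ∷ (D′ , Q) ∷ (Q , P) ∷ []

joins : ∀ {m n} → Vec (Fin n × Fin n) m → Fin n → Fin n → Fin m → Bool
joins es s t l = let u , v = lookup es l in ((u == s) ∧ (v == t)) ∨ ((u == t) ∧ (v == s))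

link : Fin 8 → Fin 8 → Maybe (Fin 17)
link s t = find (joins links s t)

joins-sound : ∀ {m n} (es : Vec (Fin n × Fin n) m) s t {l} → find (joins es s t) ≡ just l →
  lookup es l ≡ (s , t) ⊎ lookup es l ≡ (t , s)
joins-sound es s t {l} p with ∨-split (find-sound (joins es s t) p)
... | inj₁ q = let a , b = ∧-split q in inj₁ (cong₂ _,_ (==-sound a) (==-sound b))
... | inj₂ q = let a , b = ∧-split q in inj₂ (cong₂ _,_ (==-sound a) (==-sound b))

data Loc : Set where
  base hub : Loc
  inner    : Fin 3 → Fin 6 → Loc

Vertex : Set
Vertex = Fin 4 × Loc

-- A block has 2 + 3 · 6 = 20 vertices, and four blocks give 80.
locate : Fin 20 → Loc
locate zero          = base
locate (suc zero)    = hub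
locate (suc (suc r)) = uncurry inner (remQuot 6 r)

index : Loc → Fin 20
index base        = zero
index hub         = suc zero
index (inner k s) = suc (suc (combine k s))

decode : Fin 80 → Vertex
decode u = let i , r = remQuot 20 u in i , locate r

encode : Vertex → Fin 80
encode (i , l) = combine i (index l)

locate-index : ∀ l → locate (index l) ≡ l
locate-index base        = refl
locate-index hub         = refl
locate-index (inner k s) = cong (uncurry inner) (Fₚ.remQuot-combine k s)

index-locate : ∀ r → index (locate r) ≡ r
index-locate zero          = refl
index-locate (suc zero)    = refl
index-locate (suc (suc r)) = cong (λ r → suc (suc r)) (Fₚ.combine-remQuot {3} 6 r)

decode-encode : ∀ v → decode (encode v) ≡ v
decode-encode (i , l) = trans (cong (λ (i , r) → i , locate r) (Fₚ.remQuot-combine i (index l)))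
                              (cong (i ,_) (locate-index l))

encode-decode : ∀ u → encode (decode u) ≡ u
encode-decode u = trans (cong (combine (proj₁ (remQuot {4} 20 u))) (index-locate _)) (Fₚ.combine-remQuot {4} 20 u)

adj8 : Fin 8 → Fin 8 → Bool
adj8 s t = is-just (link s t)

adjLoc : Loc → Loc → Bool
adjLoc base        base          = false
adjLoc base        hub           = true
adjLoc base        (inner _ t)   = adj8 V (suc (suc t))
adjLoc hub         base          = true
adjLoc hub         hub           = false
adjLoc hub         (inner _ t)   = adj8 W (suc (suc t))
adjLoc (inner _ s) base          = adj8 (suc (suc s)) V
adjLoc (inner _ s) hub           = adj8 (suc (suc s)) W
adjLoc (inner k s) (inner k′ t)  = (k == k′) ∧ adj8 (suc (suc s)) (suc (suc t))

isBase : Loc → Bool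
isBase base        = true
isBase hub         = false
isBase (inner _ _) = false

adjV : Vertex → Vertex → Bool
adjV (i , l) (i′ , l′) = if i == i′ then adjLoc l l′ else isBase l ∧ isBase l′

_≐_ : Bool → Bool → Bool
true  ≐ b = b
false ≐ b = not b

≐-sound : ∀ {b c} → b ≐ c ≡ true → b ≡ c
≐-sound {true}  {true}  _ = refl
≐-sound {false} {false} _ = refl

adj8-sym : ∀ s t → adj8 s t ≡ adj8 t s
adj8-sym s t = ≐-sound (decide (∀′ λ s → ∀′ λ t → ⟨ adj8 s t ≐ adj8 t s ⟩) refl s t)

adj8-irrefl : ∀ s → adj8 s s ≡ false
adj8-irrefl s = ≐-sound (decide (∀′ λ s → ⟨ adj8 s s ≐ false ⟩) refl s)

adjLoc-sym : ∀ l l′ → adjLoc l l′ ≡ adjLoc l′ l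
adjLoc-sym base        base         = refl
adjLoc-sym base        hub          = refl
adjLoc-sym base        (inner _ t)  = adj8-sym V (suc (suc t))
adjLoc-sym hub         base         = refl
adjLoc-sym hub         hub          = refl
adjLoc-sym hub         (inner _ t)  = adj8-sym W (suc (suc t))
adjLoc-sym (inner _ s) base         = adj8-sym (suc (suc s)) V
adjLoc-sym (inner _ s) hub          = adj8-sym (suc (suc s)) W
adjLoc-sym (inner k s) (inner k′ t) = cong₂ _∧_ (==-sym k k′) (adj8-sym (suc (suc s)) (suc (suc t)))

adjV-sym : ∀ u t → adjV u t ≡ adjV t u
adjV-sym (i , l) (i′ , l′) rewrite ==-sym i i′ | adjLoc-sym l l′ | ∧-comm (isBase l) (isBase l′) = refl

adjV-irrefl : ∀ u → adjV u u ≡ false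
adjV-irrefl (i , base)      rewrite ==-refl i = refl
adjV-irrefl (i , hub)       rewrite ==-refl i = refl
adjV-irrefl (i , inner k s) rewrite ==-refl i | ==-refl k = adj8-irrefl (suc (suc s))

G₈₀ : Graph
G₈₀ = record
  { n      = 80
  ; adj    = λ u t → adjV (decode u) (decode t)
  ; sym    = λ u t → adjV-sym (decode u) (decode t)
  ; irrefl = λ u → adjV-irrefl (decode u)
  }

-- A straight-line drawing

ι : ℕ → ℚ
ι zero    = 0ℚ
ι (suc n) = 1ℚ +ℚ ι n

ι-+ : ∀ m n → ι (m + n) ≡ ι m +ℚ ι n
ι-+ zero    n = ≡-sym (ℚₚ.+-identityˡ (ι n))
ι-+ (suc m) n = trans (cong (1ℚ +ℚ_) (ι-+ m n)) (≡-sym (ℚₚ.+-assoc 1ℚ (ι m) (ι n)))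

ι-* : ∀ m n → ι (m * n) ≡ ι m *ℚ ι n
ι-* zero    n = ≡-sym (ℚₚ.*-zeroˡ (ι n))
ι-* (suc m) n = trans (ι-+ n (m * n)) (trans (cong (ι n +ℚ_) (ι-* m n))
  (trans (cong (_+ℚ ι m *ℚ ι n) (≡-sym (ℚₚ.*-identityˡ (ι n)))) (≡-sym (ℚₚ.*-distribʳ-+ (ι n) 1ℚ (ι m)))))

0<1 : 0ℚ <ℚ 1ℚ
0<1 = ℚₚ.positive⁻¹ 1ℚ

0≤ι : ∀ n → 0ℚ ≤ℚ ι n
0≤ι zero    = ℚₚ.≤-refl
0≤ι (suc n) = subst (_≤ℚ 1ℚ +ℚ ι n) (ℚₚ.+-identityˡ 0ℚ) (ℚₚ.+-mono-≤ (ℚₚ.<⇒≤ 0<1) (0≤ι n))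

ι-< : ∀ {m n} → m < n → ι m <ℚ ι n
ι-< {zero}  {suc n} _       = subst (_<ℚ 1ℚ +ℚ ι n) (ℚₚ.+-identityˡ 0ℚ) (ℚₚ.+-mono-<-≤ 0<1 (0≤ι n))
ι-< {suc m} {suc n} (s≤s h) = ℚₚ.+-monoʳ-< 1ℚ (ι-< h)

-- Twice the signed area of the triangle ABP.
cross : Point → Point → Point → ℚ
cross (ax , ay) (bx , by) (px , py) = (bx -ℚ ax) *ℚ (py -ℚ ay) -ℚ (by -ℚ ay) *ℚ (px -ℚ ax)

mix : ℚ → ℚ → ℚ → ℚ
mix t a b = a +ℚ t *ℚ (b -ℚ a)

cross-affine : ∀ A B P Q {X} → ((t , _) : OnSegment P Q X) →
  cross A B X ≡ mix t (cross A B P) (cross A B Q)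
cross-affine (ax , ay) (bx , by) (px , py) (qx , qy) (t , _ , _ , refl , refl) =
  solve 9 (λ ax ay bx by px py qx qy t →
    (bx :- ax) :* ((py :+ t :* (qy :- py)) :- ay) :- (by :- ay) :* ((px :+ t :* (qx :- px)) :- ax) :=
    ((bx :- ax) :* (py :- ay) :- (by :- ay) :* (px :- ax)) :+
    t :* (((bx :- ax) :* (qy :- ay) :- (by :- ay) :* (qx :- ax)) :- ((bx :- ax) :* (py :- ay) :- (by :- ay) :* (px :- ax))))
    refl ax ay bx by px py qx qy t

cross-start : ∀ A B → cross A B A ≡ 0ℚ
cross-start (ax , ay) (bx , by) = solve 4 (λ ax ay bx by →
  (bx :- ax) :* (ay :- ay) :- (by :- ay) :* (ax :- ax) := con 0ℚ) refl ax ay bx by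

cross-end : ∀ A B → cross A B B ≡ 0ℚ
cross-end (ax , ay) (bx , by) = solve 4 (λ ax ay bx by →
  (bx :- ax) :* (by :- ay) :- (by :- ay) :* (bx :- ax) := con 0ℚ) refl ax ay bx by

mix-zero : ∀ t → mix t 0ℚ 0ℚ ≡ 0ℚ
mix-zero t = solve 1 (λ t → con 0ℚ :+ t :* (con 0ℚ :- con 0ℚ) := con 0ℚ) refl t

cross-on : ∀ A B {X} → OnSegment A B X → cross A B X ≡ 0ℚ
cross-on A B s = trans (cross-affine A B A B s)
  (trans (cong₂ (λ u v → mix (proj₁ s) u v) (cross-start A B) (cross-end A B)) (mix-zero (proj₁ s)))

reverse : ∀ A B {X} → OnSegment A B X → OnSegment B A X
reverse (ax , ay) (bx , by) (t , 0≤t , t≤1 , refl , refl) =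
  1ℚ -ℚ t , subst (_≤ℚ 1ℚ -ℚ t) (ℚₚ.+-inverseʳ t) (ℚₚ.+-monoˡ-≤ (Data.Rational.- t) t≤1)
  , subst (1ℚ -ℚ t ≤ℚ_) (ℚₚ.+-identityʳ 1ℚ) (ℚₚ.+-monoʳ-≤ 1ℚ (ℚₚ.neg-antimono-≤ 0≤t)) , flip ax bx , flip ay by
  where
  flip : ∀ a b → mix t a b ≡ mix (1ℚ -ℚ t) b a
  flip a b = solve 3 (λ t a b → a :+ t :* (b :- a) := b :+ (con 1ℚ :- t) :* (a :- b)) refl t a b

0≤-* : ∀ {p q} → 0ℚ ≤ℚ p → 0ℚ ≤ℚ q → 0ℚ ≤ℚ p *ℚ q
0≤-* {p} {q} h k = ℚₚ.nonNegative⁻¹ (p *ℚ q)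
  {{ℚₚ.nonNeg*nonNeg⇒nonNeg p {{nonNegative h}} q {{nonNegative k}}}}

0≤-− : ∀ {p q} → p ≤ℚ q → 0ℚ ≤ℚ q -ℚ p
0≤-− {p} {q} h = subst (_≤ℚ q -ℚ p) (ℚₚ.+-inverseʳ p) (ℚₚ.+-monoˡ-≤ (Data.Rational.- p) h)

-- Written from the smaller of `u` and `v`, the combination is a positive number plus a nonnegative
-- one.
mix-positive : ∀ {t u v} → 0ℚ ≤ℚ t → t ≤ℚ 1ℚ → 0ℚ <ℚ u → 0ℚ <ℚ v → 0ℚ <ℚ mix t u v
mix-positive {t} {u} {v} 0≤t t≤1 hu hv with ℚₚ.≤-total u v
... | inj₁ u≤v = subst (_<ℚ mix t u v) (ℚₚ.+-identityˡ 0ℚ) (ℚₚ.+-mono-<-≤ hu (0≤-* 0≤t (0≤-− u≤v)))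
... | inj₂ v≤u = subst₂ _<ℚ_ (ℚₚ.+-identityˡ 0ℚ)
  (solve 3 (λ t u v → v :+ (con 1ℚ :- t) :* (u :- v) := u :+ t :* (v :- u)) refl t u v)
  (ℚₚ.+-mono-<-≤ hv (0≤-* (0≤-− t≤1) (0≤-− v≤u)))

-- The function `cross A B` vanishes on AB, but is affine and hence positive along CD.
left-misses : ∀ A B C D {X} → 0ℚ <ℚ cross A B C → 0ℚ <ℚ cross A B D → OnSegment A B X → OnSegment C D X → ⊥
left-misses A B C D c d s s′@(t , 0≤t , t≤1 , _) = ℚₚ.<-irrefl (≡-sym (cross-on A B s))
  (subst (0ℚ <ℚ_) (≡-sym (cross-affine A B C D s′)) (mix-positive 0≤t t≤1 c d))

-- At parameter t on AD the value of `cross A B` is t times its value at D. It must vanish on AB, so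
-- t = 0.
meet-at-start : ∀ A B D {X} → cross A B D ≢ 0ℚ → OnSegment A B X → OnSegment A D X → X ≡ A
meet-at-start A@(ax , ay) B D@(dx , dy) h s s′@(t , _ , _ , refl , refl) = cong₂ _,_ (stay ax dx) (stay ay dy)
  where
  k = cross A B D
  tk : t *ℚ k ≡ 0ℚ
  tk = trans (solve 2 (λ t k → t :* k := con 0ℚ :+ t :* (k :- con 0ℚ)) refl t k)
    (trans (cong (λ u → mix t u k) (≡-sym (cross-start A B))) (trans (≡-sym (cross-affine A B A D s′)) (cross-on A B s)))
  t≡0 : t ≡ 0ℚ
  t≡0 = trans (≡-sym (ℚₚ.*-identityʳ t)) (trans (cong (t *ℚ_) (≡-sym (ℚₚ.*-inverseʳ k))) (trans (≡-sym (ℚₚ.*-assoc t k (1/ k)))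
    (trans (cong (_*ℚ 1/ k) tk) (ℚₚ.*-zeroˡ (1/ k)))))
    where instance _ = ≢-nonZero h
  stay : ∀ a b → mix t a b ≡ a
  stay a b = trans (cong (λ t → mix t a b) t≡0) (solve 2 (λ a b → a :+ con 0ℚ :* (b :- a) := a) refl a b)

Pointℕ : Set
Pointℕ = ℕ × ℕ

ι² : Pointℕ → Point
ι² (x , y) = ι x , ι y

-- C lies strictly to the left of AB; the two sides of the comparison collect the positive and the
-- negative terms of the cross product.
left : Pointℕ → Pointℕ → Pointℕ → Bool
left (ax , ay) (bx , by) (cx , cy) = bx * ay + (ax * cy + by * cx) <ᵇ bx * cy + (by * ax + ay * cx)

left-sound : ∀ A B C → left A B C ≡ true → 0ℚ <ℚ cross (ι² A) (ι² B) (ι² C)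
left-sound (ax , ay) (bx , by) (cx , cy) h =
  subst₂ _<ℚ_ (ℚₚ.+-inverseʳ (ι N)) eq (ℚₚ.+-monoˡ-< (Data.Rational.- ι N) (ι-< (ℕₚ.<ᵇ⇒< N M (subst T (≡-sym h) _))))
  where
  N = bx * ay + (ax * cy + by * cx)
  M = bx * cy + (by * ax + ay * cx)
  expand : ∀ a b c d e f → ι (a * b + (c * d + e * f)) ≡ ι a *ℚ ι b +ℚ (ι c *ℚ ι d +ℚ ι e *ℚ ι f)
  expand a b c d e f = trans (ι-+ (a * b) (c * d + e * f)) (cong₂ _+ℚ_ (ι-* a b)
    (trans (ι-+ (c * d) (e * f)) (cong₂ _+ℚ_ (ι-* c d) (ι-* e f))))
  eq : ι M -ℚ ι N ≡ cross (ι ax , ι ay) (ι bx , ι by) (ι cx , ι cy)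
  eq = trans (cong₂ _-ℚ_ (expand bx cy by ax ay cx) (expand bx ay ax cy by cx))
    (solve 6 (λ ax ay bx by cx cy →
      (bx :* cy :+ (by :* ax :+ ay :* cx)) :- (bx :* ay :+ (ax :* cy :+ by :* cx)) :=
      (bx :- ax) :* (cy :- ay) :- (by :- ay) :* (cx :- ax)) refl (ι ax) (ι ay) (ι bx) (ι by) (ι cx) (ι cy))

sameSide : Pointℕ → Pointℕ → Pointℕ → Pointℕ → Bool
sameSide A B C D = (left A B C ∧ left A B D) ∨ (left B A C ∧ left B A D)

sameSide-misses : ∀ A B C D → sameSide A B C D ≡ true →
  ∀ {X} → OnSegment (ι² A) (ι² B) X → OnSegment (ι² C) (ι² D) X → ⊥
sameSide-misses A B C D h s s′ with ∨-split {left A B C ∧ left A B D} h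
... | inj₁ l = let p , q = ∧-split {left A B C} l in
  left-misses (ι² A) (ι² B) (ι² C) (ι² D) (left-sound A B C p) (left-sound A B D q) s s′
... | inj₂ r = let p , q = ∧-split {left B A C} r in
  left-misses (ι² B) (ι² A) (ι² C) (ι² D) (left-sound B A C p) (left-sound B A D q) (reverse (ι² A) (ι² B) s) s′

-- The edge from base to hub is vertical, with one gadget to its left and two to its right. In each
-- gadget a is above p and q, d below them, x to their left and z to their right.
local : Loc → Pointℕ
local base        = 14 , 0
local hub         = 14 , 80
local (inner k s) = 16 * toℕ k + across s , lower k (height s)
  where
  across height : Fin 6 → ℕ
  across s = lookup (0 ∷ 12 ∷ 6 ∷ 6 ∷ 4 ∷ 8 ∷ []) s
  height s = lookup (41 ∷ 40 ∷ 47 ∷ 33 ∷ 40 ∷ 41 ∷ []) s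
  lower : Fin 3 → ℕ → ℕ
  lower zero    y = y
  lower (suc _) y = y ∸ 3

-- The third block hangs below its base vertex, the others stand above theirs.
place : Fin 4 → Pointℕ → Pointℕ
place zero                   (x , y) = 37 + x , 263 + y
place (suc zero)             (x , y) = 327 + x , 262 + y
place (suc (suc zero))       (x , y) = 184 + x , 90 ∸ y
place (suc (suc (suc zero))) (x , y) = 187 + x , 156 + y

-- Finite checks that certify the drawing

Located : Set
Located = Fin 80 × Pointℕ

Segment : Set
Segment = Located × Located

isEdge : Segment → Bool
isEdge ((u , _) , (t , _)) = adjV (decode u) (decode t)

every-sound : ∀ {A : Set} (f : A → Bool) {xs x} → every f xs ≡ true → x ∈ xs → f x ≡ true
every-sound f {x ∷ₗ xs} h (here refl) = proj₁ (∧-split h)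
every-sound f {x ∷ₗ xs} h (there p)   = every-sound f (proj₂ (∧-split {f x} h)) p


-- Edges without a common vertex are separated by the line through one of them; edges with a common
-- vertex are treated by `meet-at`.
crossOrShare : Segment → Segment → Bool
crossOrShare ((a , A) , (b , B)) ((c , C) , (d , D)) =
  sameSide A B C D ∨ (sameSide C D A B ∨ (((a == c) ∨ (a == d)) ∨ ((b == c) ∨ (b == d))))

-- The whole line is avoided, not only the segment. Hence two edges at a common vertex are never
-- collinear, which `meet-at` uses.
offLine : Segment → Located → Bool
offLine ((a , A) , (b , B)) (w , C) = (left A B C ∨ left B A C) ∨ ((w == a) ∨ (w == b))

separated : Located → Located → Bool
separated (u , (ux , uy)) (t , (tx , ty)) = (u == t) ∨ not ((ux ≡ᵇ tx) ∧ (uy ≡ᵇ ty))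

pairwise : ∀ {A B : Set} → (A → B → Bool) → List A → List B → Bool
pairwise f xs ys = every (λ x → every (f x) ys) xs

listing : ∀ {A : Set} n → (Fin n → A) → List (Fin n × A)
listing n f = map (λ u → u , f u) (allFin n)

∈-listing : ∀ {A : Set} n (f : Fin n → A) u → (u , f u) ∈ listing n f
∈-listing n f u = ∈-map⁺ (λ u → u , f u) (∈-allFin u)

pairsWhere : ∀ {A : Set} → (A × A → Bool) → List A → List (A × A)
pairsWhere p xs = filter (λ e → T? (p e)) (cartesianProduct xs xs)

∈-pairsWhere : ∀ {A : Set} (p : A × A → Bool) xs {x y} → x ∈ xs → y ∈ xs → p (x , y) ≡ true → (x , y) ∈ pairsWhere p xs
∈-pairsWhere p xs x∈ y∈ h = ∈-filter⁺ (λ e → T? (p e)) (∈-cartesianProduct⁺ x∈ y∈) (subst T (≡-sym h) _)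

abstract
  point : Fin 80 → Pointℕ
  point u = let i , l = decode u in place i (local l)

  vertices : List Located
  vertices = listing 80 point

  segments : List Segment
  segments = pairsWhere isEdge vertices

  ∈-vertices : ∀ u → (u , point u) ∈ vertices
  ∈-vertices = ∈-listing 80 point

  ∈-segments : ∀ u t → adj G₈₀ u t ≡ true → ((u , point u) , (t , point t)) ∈ segments
  ∈-segments u t = ∈-pairsWhere isEdge vertices (∈-vertices u) (∈-vertices t)

  all-separated : pairwise separated vertices vertices ≡ true
  all-separated = refl

  all-offLine : pairwise offLine segments vertices ≡ true
  all-offLine = refl

  all-crossOrShare : pairwise crossOrShare segments segments ≡ true
  all-crossOrShare = refl

position : Fin 80 → Point
position u = ι² (point u)

pairwise-sound : ∀ {A B : Set} (f : A → B → Bool) {xs ys x y} → pairwise f xs ys ≡ true → x ∈ xs → y ∈ ys → f x y ≡ true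
pairwise-sound f {ys = ys} h p q = every-sound (f _) (every-sound (λ x → every (f x) ys) h p) q

ι-injective : ∀ m n → ι m ≡ ι n → (m ≡ᵇ n) ≡ true
ι-injective m n p with ℕₚ.<-cmp m n
... | tri< m<n _ _  = ⊥-elim (ℚₚ.<-irrefl p (ι-< m<n))
... | tri> _ _ n<m  = ⊥-elim (ℚₚ.<-irrefl (≡-sym p) (ι-< n<m))
... | tri≈ _ refl _ = T-true (ℕₚ.≡⇒≡ᵇ n n refl)
  where
  T-true : ∀ {b} → T b → b ≡ true
  T-true {true} _ = refl

separated-cases : ∀ u t x y x′ y′ → separated (u , (x , y)) (t , (x′ , y′)) ≡ true →
  ι x ≡ ι x′ → ι y ≡ ι y′ → u ≡ t
separated-cases u t x y x′ y′ h p q with ∨-split {u == t} h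
... | inj₁ k = ==-sound k
... | inj₂ k = ⊥-elim (true≢false (cong₂ _∧_ (ι-injective x x′ p) (ι-injective y y′ q)) (not-true k))

position-injective : ∀ u t → position u ≡ position t → u ≡ t
position-injective u t p = separated-cases u t (proj₁ (point u)) (proj₂ (point u)) (proj₁ (point t)) (proj₂ (point t))
  (pairwise-sound separated all-separated (∈-vertices u) (∈-vertices t)) (cong proj₁ p) (cong proj₂ p)

cross-swap : ∀ A B C → cross B A C ≡ Data.Rational.- cross A B C
cross-swap (ax , ay) (bx , by) (cx , cy) = solve 6 (λ ax ay bx by cx cy →
  (ax :- bx) :* (cy :- by) :- (ay :- by) :* (cx :- bx) := :- ((bx :- ax) :* (cy :- ay) :- (by :- ay) :* (cx :- ax)))
  refl ax ay bx by cx cy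

offLine-nonzero : ∀ a b w A B C → offLine ((a , A) , (b , B)) (w , C) ≡ true → w ≢ a → w ≢ b →
  cross (ι² A) (ι² B) (ι² C) ≢ 0ℚ
offLine-nonzero a b w A B C h w≢a w≢b null with ∨-split {left A B C ∨ left B A C} h
... | inj₂ k with ∨-split {w == a} k
...   | inj₁ l = w≢a (==-sound l)
...   | inj₂ l = w≢b (==-sound l)
offLine-nonzero a b w A B C h w≢a w≢b null | inj₁ k with ∨-split {left A B C} k
... | inj₁ l = ℚₚ.<-irrefl (≡-sym null) (left-sound A B C l)
... | inj₂ l = ℚₚ.<-irrefl (≡-sym (trans (cross-swap (ι² A) (ι² B) (ι² C)) (cong Data.Rational.-_ null))) (left-sound B A C l)

cross-nonzero : ∀ a b w → adj G₈₀ a b ≡ true → w ≢ a → w ≢ b → cross (position a) (position b) (position w) ≢ 0ℚ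
cross-nonzero a b w e = offLine-nonzero a b w (point a) (point b) (point w)
  (pairwise-sound offLine all-offLine (∈-segments a b e) (∈-vertices w))

vertex-off : ∀ a b w → adj G₈₀ a b ≡ true → w ≢ a → w ≢ b → ¬ OnSegment (position a) (position b) (position w)
vertex-off a b w e w≢a w≢b s = cross-nonzero a b w e w≢a w≢b (cross-on (position a) (position b) s)

meet-at : ∀ a b d → adj G₈₀ a b ≡ true → b ≢ d → d ≢ a → ∀ {X} →
  OnSegment (position a) (position b) X → OnSegment (position a) (position d) X → X ≡ position a
meet-at a b d e b≢d d≢a = meet-at-start (position a) (position b) (position d) (cross-nonzero a b d e d≢a (≢-sym b≢d))

loopless : ∀ a b → adj G₈₀ a b ≡ true → b ≢ a
loopless a .a e refl = true≢false e (irrefl G₈₀ a)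

disjoint-misses : ∀ a b c d A B C D → crossOrShare ((a , A) , (b , B)) ((c , C) , (d , D)) ≡ true →
  a ≢ c → a ≢ d → b ≢ c → b ≢ d → ∀ {Y} → OnSegment (ι² A) (ι² B) Y → OnSegment (ι² C) (ι² D) Y → ⊥
disjoint-misses a b c d A B C D h a≢c a≢d b≢c b≢d s s′ with ∨-split {sameSide A B C D} h
... | inj₁ k = sameSide-misses A B C D k s s′
... | inj₂ k with ∨-split {sameSide C D A B} k
...   | inj₁ l = sameSide-misses C D A B l s′ s
...   | inj₂ l rewrite ≢⇒== a≢c | ≢⇒== a≢d | ≢⇒== b≢c | ≢⇒== b≢d with l
...     | ()

-- A common vertex is the meeting point: both segments are reversed as needed to start there, and
-- their other ends are distinct.
no-cross : ∀ a b c d → adj G₈₀ a b ≡ true → adj G₈₀ c d ≡ true → ¬ ((a ≡ c × b ≡ d) ⊎ (a ≡ d × b ≡ c)) →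
  ∀ X → OnSegment (position a) (position b) X → OnSegment (position c) (position d) X →
  Σ (Fin 80) λ w → (w ≡ a ⊎ w ≡ b) × (w ≡ c ⊎ w ≡ d) × (X ≡ position w)
no-cross a b c d e f different Y s s′ with a F.≟ c | a F.≟ d | b F.≟ c | b F.≟ d
... | yes refl | _ | _ | _ = a , inj₁ refl , inj₁ refl ,
  meet-at a b d e (λ p → different (inj₁ (refl , p))) (loopless a d f) s s′
... | no _ | yes refl | _ | _ = a , inj₁ refl , inj₂ refl ,
  meet-at a b c e (λ p → different (inj₂ (refl , p))) (≢-sym (loopless c a f)) s (reverse (position c) (position a) s′)
... | no _ | no a≢d | yes refl | _ = b , inj₂ refl , inj₁ refl ,
  meet-at b a d (trans (sym G₈₀ b a) e) a≢d (loopless b d f) (reverse (position a) (position b) s) s′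
... | no a≢c | no _ | no _ | yes refl = b , inj₂ refl , inj₂ refl ,
  meet-at b a c (trans (sym G₈₀ b a) e) a≢c (≢-sym (loopless c b f))
    (reverse (position a) (position b) s) (reverse (position c) (position b) s′)
... | no a≢c | no a≢d | no b≢c | no b≢d = ⊥-elim (disjoint-misses a b c d (point a) (point b) (point c) (point d)
  (pairwise-sound crossOrShare all-crossOrShare (∈-segments a b e) (∈-segments c d f)) a≢c a≢d b≢c b≢d s s′)

planar : Planar G₈₀
planar = record
  { pos       = position
  ; injective = position-injective
  ; vertexOff = vertex-off
  ; noCross   = no-cross
  }

-- A cover with four colours and no proper colouring

-- The matchings come from a computer search.
swap₀₂ swap₁₂ swap₀₃ swap₂₃ identity dp₄ dq₄ qp₄ : Vec (Fin 4) 4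
identity = # 0 ∷ # 1 ∷ # 2 ∷ # 3 ∷ []
swap₀₂ = # 2 ∷ # 1 ∷ # 0 ∷ # 3 ∷ []
swap₁₂ = # 0 ∷ # 2 ∷ # 1 ∷ # 3 ∷ []
swap₀₃ = # 3 ∷ # 1 ∷ # 2 ∷ # 0 ∷ []
swap₂₃ = # 0 ∷ # 1 ∷ # 3 ∷ # 2 ∷ []
dp₄    = # 2 ∷ # 0 ∷ # 3 ∷ # 1 ∷ []
dq₄    = # 3 ∷ # 0 ∷ # 2 ∷ # 1 ∷ []
qp₄    = # 0 ∷ # 2 ∷ # 3 ∷ # 1 ∷ []

Conflicts : Set
Conflicts = Fin 4 → Fin 4 → Bool

only : Fin 4 → Fin 4 → Conflicts
only i j i′ j′ = (i == i′) ∧ (j == j′)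

along : Vec (Fin 4) 4 → Conflicts
along π i j = lookup π i == j

-- The k-th gadget of a block excludes colour k of the hub together with colour 3 of the base; the ends
-- conflict only in these colours, and leave x and z the colours 0, 1 and a and d the colours 0, 1, 2.
table4 : Fin 3 → Vec Conflicts 17
table4 k =
  only (inject₁ k) (# 2) ∷ only (# 3) (# 3) ∷ only (inject₁ k) (# 2) ∷ only (# 3) (# 3) ∷
  only (inject₁ k) (# 3) ∷ only (# 3) (# 3) ∷
  along swap₀₂ ∷ along identity ∷ along swap₁₂ ∷ along identity ∷ along swap₀₂ ∷ along swap₀₃ ∷
  along swap₂₃ ∷ along dp₄ ∷ along identity ∷ along dq₄ ∷ along qp₄ ∷ []

forward : Fin 8 → Fin 8 → Fin 17 → Bool
forward s t l = (proj₁ (lookup links l) == s) ∧ (proj₂ (lookup links l) == t)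

conflict8 : Fin 3 → Fin 8 → Fin 8 → Conflicts
conflict8 k s t i j with link s t
... | nothing = false
... | just l  = if forward s t l then lookup (table4 k) l i j else lookup (table4 k) l j i

conflictLoc : Loc → Loc → Conflicts
conflictLoc base        base         i j = false
-- Colour 3 at the base leaves the hub the colours 0, 1, 2, one to be excluded by each gadget.
conflictLoc base        hub          i j = i == j
conflictLoc base        (inner k t)  i j = conflict8 k V (suc (suc t)) i j
conflictLoc hub         base         i j = i == j
conflictLoc hub         hub          i j = false
conflictLoc hub         (inner k t)  i j = conflict8 k W (suc (suc t)) i j
conflictLoc (inner k s) base         i j = conflict8 k (suc (suc s)) V i j
conflictLoc (inner k s) hub          i j = conflict8 k (suc (suc s)) W i j
conflictLoc (inner k s) (inner k′ t) i j = (k == k′) ∧ conflict8 k (suc (suc s)) (suc (suc t)) i j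

conflictV : Vertex → Vertex → Conflicts
conflictV (b , l) (b′ , l′) i j = if b == b′ then conflictLoc l l′ i j else (isBase l ∧ isBase l′) ∧ (i == j)

conflict8-sym : ∀ k s t i j → conflict8 k s t i j ≡ conflict8 k t s j i
conflict8-sym k s t i j = ≐-sound (decide (∀′ λ k → ∀′ λ s → ∀′ λ t → ∀′ λ i → ∀′ λ j →
  ⟨ conflict8 k s t i j ≐ conflict8 k t s j i ⟩) refl k s t i j)

conflict8-matching : ∀ k s t i j j′ → conflict8 k s t i j ≡ true → conflict8 k s t i j′ ≡ true → j ≡ j′
conflict8-matching k s t i j j′ p q = ==-sound (decide (∀′ λ k → ∀′ λ s → ∀′ λ t → ∀′ λ i → ∀′ λ j → ∀′ λ j′ →
  unless not (conflict8 k s t i j) then unless not (conflict8 k s t i j′) then ⟨ j == j′ ⟩) refl k s t i j j′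
  (cong not p) (cong not q))

conflict8-adj : ∀ k s t i j → adj8 s t ≡ false → conflict8 k s t i j ≡ false
conflict8-adj k s t i j p with link s t
... | nothing = refl

conflictLoc-sym : ∀ l l′ i j → conflictLoc l l′ i j ≡ conflictLoc l′ l j i
conflictLoc-sym base        base         i j = refl
conflictLoc-sym base        hub          i j = ==-sym i j
conflictLoc-sym base        (inner k t)  i j = conflict8-sym k V (suc (suc t)) i j
conflictLoc-sym hub         base         i j = ==-sym i j
conflictLoc-sym hub         hub          i j = refl
conflictLoc-sym hub         (inner k t)  i j = conflict8-sym k W (suc (suc t)) i j
conflictLoc-sym (inner k s) base         i j = conflict8-sym k (suc (suc s)) V i j
conflictLoc-sym (inner k s) hub          i j = conflict8-sym k (suc (suc s)) W i j
conflictLoc-sym (inner k s) (inner k′ t) i j with k F.≟ k′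
... | yes refl = cong ((k == k) ∧_) (conflict8-sym k (suc (suc s)) (suc (suc t)) i j)
... | no p rewrite ≢⇒== p | ≢⇒== (≢-sym p) = refl

conflictLoc-matching : ∀ l l′ i j j′ → conflictLoc l l′ i j ≡ true → conflictLoc l l′ i j′ ≡ true → j ≡ j′
conflictLoc-matching base        hub          i j j′ p q = trans (≡-sym (==-sound {i = i} p)) (==-sound {i = i} q)
conflictLoc-matching base        (inner k t)  i j j′ p q = conflict8-matching k V (suc (suc t)) i j j′ p q
conflictLoc-matching hub         base         i j j′ p q = trans (≡-sym (==-sound {i = i} p)) (==-sound {i = i} q)
conflictLoc-matching hub         (inner k t)  i j j′ p q = conflict8-matching k W (suc (suc t)) i j j′ p q
conflictLoc-matching (inner k s) base         i j j′ p q = conflict8-matching k (suc (suc s)) V i j j′ p q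
conflictLoc-matching (inner k s) hub          i j j′ p q = conflict8-matching k (suc (suc s)) W i j j′ p q
conflictLoc-matching (inner k s) (inner k′ t) i j j′ p q = conflict8-matching k (suc (suc s)) (suc (suc t)) i j j′
  (proj₂ (∧-split {k == k′} p)) (proj₂ (∧-split {k == k′} q))

conflictLoc-adj : ∀ l l′ i j → adjLoc l l′ ≡ false → conflictLoc l l′ i j ≡ false
conflictLoc-adj base        base         i j _ = refl
conflictLoc-adj base        (inner k t)  i j p = conflict8-adj k V (suc (suc t)) i j p
conflictLoc-adj hub         hub          i j _ = refl
conflictLoc-adj hub         (inner k t)  i j p = conflict8-adj k W (suc (suc t)) i j p
conflictLoc-adj (inner k s) base         i j p = conflict8-adj k (suc (suc s)) V i j p
conflictLoc-adj (inner k s) hub          i j p = conflict8-adj k (suc (suc s)) W i j p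
conflictLoc-adj (inner k s) (inner k′ t) i j p with k == k′
... | true  = conflict8-adj k (suc (suc s)) (suc (suc t)) i j p
... | false = refl

conflictV-sym : ∀ u t i j → conflictV u t i j ≡ conflictV t u j i
conflictV-sym (b , l) (b′ , l′) i j
  rewrite ==-sym b b′ | conflictLoc-sym l l′ i j | ∧-comm (isBase l) (isBase l′) | ==-sym i j = refl

conflictV-adj : ∀ u t i j → adjV u t ≡ false → conflictV u t i j ≡ false
conflictV-adj (b , l) (b′ , l′) i j p with b == b′
... | true  = conflictLoc-adj l l′ i j p
... | false rewrite p = refl

conflictV-matching : ∀ u t i j j′ → conflictV u t i j ≡ true → conflictV u t i j′ ≡ true → j ≡ j′
conflictV-matching (b , l) (b′ , l′) i j j′ p q with b == b′
... | true  = conflictLoc-matching l l′ i j j′ p q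
... | false = trans (≡-sym (==-sound {i = i} (proj₂ (∧-split {isBase l ∧ isBase l′} p))))
                    (==-sound {i = i} (proj₂ (∧-split {isBase l ∧ isBase l′} q)))

H₄ : Cover G₈₀
H₄ = record
  { size              = λ _ → 4
  ; conflict          = λ u t → conflictV (decode u) (decode t)
  ; conflict-sym      = λ u t → conflictV-sym (decode u) (decode t)
  ; conflict-indep    = λ u i j → conflictV-adj (decode u) (decode u) i j (adjV-irrefl (decode u))
  ; conflict-nonadj   = λ u t → conflictV-adj (decode u) (decode t)
  ; conflict-matching = λ u t → conflictV-matching (decode u) (decode t)
  }

-- Colours are tried in the order x, z, a, d, p, q, and a branch is closed at the first conflict.
Blocked : Fin 3 → Form
Blocked k =
  ∀′ λ x → ⟨ hits W X (inject₁ k) x ∨ hits V X (# 3) x ⟩ ∨′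
  (∀′ λ z → ⟨ hits W Z (inject₁ k) z ∨ hits V Z (# 3) z ⟩ ∨′
  (∀′ λ a → ⟨ hits W A′ (inject₁ k) a ∨ (hits X A′ x a ∨ hits Z A′ z a) ⟩ ∨′
  (∀′ λ d → ⟨ hits V D′ (# 3) d ∨ (hits X D′ x d ∨ hits Z D′ z d) ⟩ ∨′
  (∀′ λ p → ⟨ hits X P x p ∨ (hits A′ P a p ∨ hits D′ P d p) ⟩ ∨′
  (∀′ λ q → ⟨ hits Z Q z q ∨ (hits A′ Q a q ∨ (hits D′ Q d q ∨ hits Q P q p)) ⟩)))))
  where
  hits : (s t : Fin 8) → Conflicts
  hits = conflict8 k

gadget-blocked : ∀ k → ⟦ Blocked k ⟧
gadget-blocked = decide (∀′ Blocked) refl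

count-zero : ∀ {m} (f : Fin m → Bool) → count f ≤ 0 → ∀ i → f i ≡ false
count-zero f h zero with f zero
count-zero f () zero | true
... | false = refl
count-zero f h (suc i) with f zero
count-zero f () (suc i) | true
... | false = count-zero (λ i → f (suc i)) h i

-- The pigeonhole principle for K₄: without colour 3, four base vertices share three colours.
four-distinct : ∀ i j k l → ⟦ ⟨ (i == # 3) ∨ ((j == # 3) ∨ ((k == # 3) ∨ (l == # 3))) ⟩ ∨′
  ⟨ (i == j) ∨ ((i == k) ∨ ((i == l) ∨ ((j == k) ∨ ((j == l) ∨ (k == l))))) ⟩ ⟧
four-distinct = decide (∀′ λ (i : Fin 4) → ∀′ λ (j : Fin 4) → ∀′ λ (k : Fin 4) → ∀′ λ (l : Fin 4) →
  ⟨ (i == # 3) ∨ ((j == # 3) ∨ ((k == # 3) ∨ (l == # 3))) ⟩ ∨′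
  ⟨ (i == j) ∨ ((i == k) ∨ ((i == l) ∨ ((j == k) ∨ ((j == l) ∨ (k == l))))) ⟩) refl

none : ∀ {b c} → b ≡ false → c ≡ false → b ∨ c ≡ false
none refl q = q

rest : ∀ {b} {R : Set} → b ≡ true ⊎ R → b ≡ false → R
rest (inj₁ p) q = ⊥-elim (true≢false p q)
rest (inj₂ r) _ = r

not-4-correspondable : ¬ Correspondable 4 G₈₀
not-4-correspondable h = contradiction
  where
  φ′ : Coloring H₄
  φ′ = proj₁ (h H₄ λ _ → ℕₚ.≤-refl)

  φ : Vertex → Fin 4
  φ v = φ′ (encode v)

  proper : ∀ u t → conflictV u t (φ u) (φ t) ≡ false
  proper u t = subst₂ (λ u′ t′ → conflictV u′ t′ (φ u) (φ t) ≡ false) (decode-encode u) (decode-encode t)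
    (count-zero (λ x → conflictV (decode (encode u)) (decode x) (φ u) (φ′ x)) (proj₂ (h H₄ λ _ → ℕₚ.≤-refl) (encode u)) (encode t))

  module _ (b : Fin 4) where
    in-block : ∀ l l′ → conflictLoc l l′ (φ (b , l)) (φ (b , l′)) ≡ false
    in-block l l′ with proper (b , l) (b , l′)
    ... | p rewrite ==-refl b = p

    in-gadget : ∀ k s t → conflict8 k (suc (suc s)) (suc (suc t)) (φ (b , inner k s)) (φ (b , inner k t)) ≡ false
    in-gadget k s t with in-block (inner k s) (inner k t)
    ... | p rewrite ==-refl k = p

    gadget-absurd : ∀ k → φ (b , base) ≡ # 3 → φ (b , hub) ≡ inject₁ k → ⊥
    gadget-absurd k p q = true≢false (f₅ (c (# 5)))
      (none (I! (# 1) (# 5)) (none (I! (# 2) (# 5)) (none (I! (# 3) (# 5)) (I! (# 5) (# 4)))))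
      where
      c : Fin 6 → Fin 4
      c s = φ (b , inner k s)
      V! : ∀ s → conflict8 k V (suc (suc s)) (# 3) (c s) ≡ false
      V! s = subst (λ i → conflict8 k V (suc (suc s)) i (c s) ≡ false) p (in-block base (inner k s))
      W! : ∀ s → conflict8 k W (suc (suc s)) (inject₁ k) (c s) ≡ false
      W! s = subst (λ i → conflict8 k W (suc (suc s)) i (c s) ≡ false) q (in-block hub (inner k s))
      I! = in-gadget k
      -- The actual colours select one branch of `Blocked`. Properness refutes each early conflict
      -- in turn, and the last one contradicts it.
      f₁ = rest (gadget-blocked k (c (# 0))) (none (W! (# 0)) (V! (# 0)))
      f₂ = rest (f₁ (c (# 1))) (none (W! (# 1)) (V! (# 1)))
      f₃ = rest (f₂ (c (# 2))) (none (W! (# 2)) (none (I! (# 0) (# 2)) (I! (# 1) (# 2))))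
      f₄ = rest (f₃ (c (# 3))) (none (V! (# 3)) (none (I! (# 0) (# 3)) (I! (# 1) (# 3))))
      f₅ = rest (f₄ (c (# 4))) (none (I! (# 0) (# 4)) (none (I! (# 2) (# 4)) (I! (# 3) (# 4))))

    base-not-3 : φ (b , base) == # 3 ≡ false
    base-not-3 with φ (b , base) == # 3 in p
    ... | false = refl
    ... | true with φ (b , hub) in q
    ...   | zero                   = ⊥-elim (gadget-absurd (# 0) (==-sound {i = φ (b , base)} p) q)
    ...   | suc zero               = ⊥-elim (gadget-absurd (# 1) (==-sound {i = φ (b , base)} p) q)
    ...   | suc (suc zero)         = ⊥-elim (gadget-absurd (# 2) (==-sound {i = φ (b , base)} p) q)
    ...   | suc (suc (suc zero))   = ⊥-elim (==⇒≢ {i = φ (b , base)} (in-block base hub) (trans (==-sound {i = φ (b , base)} p) (≡-sym q)))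

  contradiction : ⊥
  contradiction with four-distinct (φ (# 0 , base)) (φ (# 1 , base)) (φ (# 2 , base)) (φ (# 3 , base))
  ... | inj₁ e = true≢false e (none (base-not-3 (# 0)) (none (base-not-3 (# 1)) (none (base-not-3 (# 2)) (base-not-3 (# 3)))))
  ... | inj₂ e = true≢false e (none (apart (# 0) (# 1)) (none (apart (# 0) (# 2)) (none (apart (# 0) (# 3))
      (none (apart (# 1) (# 2)) (none (apart (# 1) (# 3)) (apart (# 2) (# 3)))))))
    where
    apart : ∀ b b′ → conflictV (b , base) (b′ , base) (φ (b , base)) (φ (b′ , base)) ≡ false
    apart b b′ = proper (b , base) (b′ , base)

-- Covers with three colours

≤-sum : ∀ {n} (f : Fin n → ℕ) i → f i ≤ sum f
≤-sum f zero    = ℕₚ.m≤m+n (f zero) _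
≤-sum f (suc i) = ℕₚ.≤-trans (≤-sum (λ i → f (suc i)) i) (ℕₚ.m≤n+m _ (f zero))

-- Converts bounds on loads into uniqueness of the conflicting neighbour, first among the parts
-- around a vertex and then within one part.
sum-unique : ∀ {n} (f : Fin n → ℕ) → sum f ≤ 1 → ∀ {i j} → 1 ≤ f i → 1 ≤ f j → i ≡ j
sum-unique f h {zero}  {zero}  p q = refl
sum-unique f h {zero}  {suc j} p q =
  ⊥-elim (ℕₚ.<⇒≱ (ℕₚ.+-mono-≤ p (ℕₚ.≤-trans q (≤-sum (λ i → f (suc i)) j))) h)
sum-unique f h {suc i} {zero}  p q = ≡-sym (sum-unique f h q p)
sum-unique f h {suc i} {suc j} p q =
  cong suc (sum-unique (λ i → f (suc i)) (ℕₚ.≤-trans (ℕₚ.m≤n+m _ (f zero)) h) p q)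

bit-1 : ∀ {b} → b ≡ true → 1 ≤ bit b
bit-1 refl = s≤s z≤n

count-unique : ∀ {n} (f : Fin n → Bool) → (∀ i j → f i ≡ true → f j ≡ true → i ≡ j) → count f ≤ 1
count-unique {zero}  f h = z≤n
count-unique {suc n} f h with f zero in eq
... | true  = s≤s (none-left (λ i → f (suc i)) λ i → not-true-false λ p → zero≢suc (h zero (suc i) eq p))
  where
  zero≢suc : ∀ {n} {i : Fin n} → F.zero ≡ suc i → ⊥
  zero≢suc ()
  not-true-false : ∀ {b} → (b ≡ true → ⊥) → b ≡ false
  not-true-false {true}  p = ⊥-elim (p refl)
  not-true-false {false} p = refl
  none-left : ∀ {n} (f : Fin n → Bool) → (∀ i → f i ≡ false) → count f ≤ 0
  none-left {zero}  f h = z≤n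
  none-left {suc n} f h with f zero | h zero
  ... | false | _ = none-left (λ i → f (suc i)) λ i → h (suc i)
... | false = count-unique (λ i → f (suc i)) λ i j p q → Fₚ.suc-injective (h (suc i) (suc j) p q)

-- Extending matchings to permutations

matrix : (b₀₀ b₀₁ b₀₂ b₁₀ b₁₁ b₁₂ b₂₀ b₂₁ b₂₂ : Bool) → Color → Color → Bool
matrix b₀₀ b₀₁ b₀₂ b₁₀ b₁₁ b₁₂ b₂₀ b₂₁ b₂₂ zero             = table b₀₀ b₀₁ b₀₂
matrix b₀₀ b₀₁ b₀₂ b₁₀ b₁₁ b₁₂ b₂₀ b₂₁ b₂₂ (suc zero)       = table b₁₀ b₁₁ b₁₂
matrix b₀₀ b₀₁ b₀₂ b₁₀ b₁₁ b₁₂ b₂₀ b₂₁ b₂₂ (suc (suc zero)) = table b₂₀ b₂₁ b₂₂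

-- A relation between two sets of three colours is contained in a permutation unless it is not a matching.
Perfect : (Color → Color → Bool) → Form
Perfect R = (∃′ λ (π : Perm) → ∀′ λ i → ∀′ λ j → unless not (R i j) then ⟨ π $ i == j ⟩)
  ∨′ ((∃′ λ i → ∃′ λ j → ∃′ λ j′ → ⟨ not (j == j′) ∧ (R i j ∧ R i j′) ⟩)
  ∨′ (∃′ λ i → ∃′ λ i′ → ∃′ λ j → ⟨ not (i == i′) ∧ (R i j ∧ R i′ j) ⟩))

abstract
  matching-perfect : ∀ b₀₀ b₀₁ b₀₂ b₁₀ b₁₁ b₁₂ b₂₀ b₂₁ b₂₂ → ⟦ Perfect (matrix b₀₀ b₀₁ b₀₂ b₁₀ b₁₁ b₁₂ b₂₀ b₂₁ b₂₂) ⟧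
  matching-perfect = decide (∀ᵇ λ b₀₀ → ∀ᵇ λ b₀₁ → ∀ᵇ λ b₀₂ → ∀ᵇ λ b₁₀ → ∀ᵇ λ b₁₁ → ∀ᵇ λ b₁₂ →
    ∀ᵇ λ b₂₀ → ∀ᵇ λ b₂₁ → ∀ᵇ λ b₂₂ → Perfect (matrix b₀₀ b₀₁ b₀₂ b₁₀ b₁₁ b₁₂ b₂₀ b₂₁ b₂₂)) refl

matrix-≡ : ∀ (R : Color → Color → Bool) i j →
  matrix (R (# 0) (# 0)) (R (# 0) (# 1)) (R (# 0) (# 2)) (R (# 1) (# 0)) (R (# 1) (# 1)) (R (# 1) (# 2))
         (R (# 2) (# 0)) (R (# 2) (# 1)) (R (# 2) (# 2)) i j ≡ R i j
matrix-≡ R zero             zero             = refl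
matrix-≡ R zero             (suc zero)       = refl
matrix-≡ R zero             (suc (suc zero)) = refl
matrix-≡ R (suc zero)       zero             = refl
matrix-≡ R (suc zero)       (suc zero)       = refl
matrix-≡ R (suc zero)       (suc (suc zero)) = refl
matrix-≡ R (suc (suc zero)) zero             = refl
matrix-≡ R (suc (suc zero)) (suc zero)       = refl
matrix-≡ R (suc (suc zero)) (suc (suc zero)) = refl

abstract
  -- Passing to the permutation can only add conflicts, so a colouring that succeeds for
  -- permutations succeeds for the cover.
  perfect : ∀ (R : Color → Color → Bool) →
    (∀ i j j′ → R i j ≡ true → R i j′ ≡ true → j ≡ j′) → (∀ i i′ j → R i j ≡ true → R i′ j ≡ true → i ≡ i′) →
    Σ[ π ∈ Perm ] (∀ i j → R i j ≡ true → π $ i ≡ j)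
  perfect R right left with matching-perfect (R (# 0) (# 0)) (R (# 0) (# 1)) (R (# 0) (# 2)) (R (# 1) (# 0)) (R (# 1) (# 1))
           (R (# 1) (# 2)) (R (# 2) (# 0)) (R (# 2) (# 1)) (R (# 2) (# 2))
  ... | inj₁ (π , h) = π , λ i j r → ==-sound (h i j (cong not (trans (matrix-≡ R i j) r)))
  ... | inj₂ (inj₁ (i , j , j′ , h)) = let r = ∧-split (proj₂ (∧-split {not (j == j′)} h)) in
    ⊥-elim (==⇒≢ (not-true (proj₁ (∧-split h)))
      (right i j j′ (trans (≡-sym (matrix-≡ R i j)) (proj₁ r)) (trans (≡-sym (matrix-≡ R i j′)) (proj₂ r))))
  ... | inj₂ (inj₂ (i , i′ , j , h)) = let r = ∧-split (proj₂ (∧-split {not (i == i′)} h)) in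
    ⊥-elim (==⇒≢ (not-true (proj₁ (∧-split h)))
      (left i i′ j (trans (≡-sym (matrix-≡ R i j)) (proj₁ r)) (trans (≡-sym (matrix-≡ R i′ j)) (proj₂ r))))

-- Conflict counts in K₄ and in a gadget

pairs4 : Vec (Fin 4 × Fin 4) 6
pairs4 = (# 0 , # 1) ∷ (# 0 , # 2) ∷ (# 0 , # 3) ∷ (# 1 , # 2) ∷ (# 1 , # 3) ∷ (# 2 , # 3) ∷ []

-- Spreads a vector of edge flags to a relation on vertices; pairs that are not edges get `false`.
meet : ∀ {m n} → Vec (Fin n × Fin n) m → Vec Bool m → Fin n → Fin n → Bool
meet es b s t = maybe (lookup b) false (find (joins es s t))

quad : ∀ {A : Set} → A → A → A → A → Fin 4 → A
quad x₀ x₁ x₂ x₃ zero                   = x₀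
quad x₀ x₁ x₂ x₃ (suc zero)             = x₁
quad x₀ x₁ x₂ x₃ (suc (suc zero))       = x₂
quad x₀ x₁ x₂ x₃ (suc (suc (suc zero))) = x₃

-- The colours of the base vertices are named after those of vertex 0, so no permutation is needed there.
baseBits : (π₁₂ π₁₃ π₂₃ : Perm) (j : Fin 4 → Color) → Vec Bool 6
baseBits π₁₂ π₁₃ π₂₃ j = (j (# 0) == j (# 1)) ∷ (j (# 0) == j (# 2)) ∷ (j (# 0) == j (# 3)) ∷
  (π₁₂ $ j (# 1) == j (# 2)) ∷ (π₁₃ $ j (# 1) == j (# 3)) ∷ (π₂₃ $ j (# 2) == j (# 3)) ∷ []

degree4 : Vec Bool 6 → Fin 4 → ℕ
degree4 b i = sum λ i′ → bit (meet pairs4 b i i′)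

-- Vertex i takes one of the conflicts of the base graph, or one from its block if its colour is unsafe.
settled : (b₀₁ b₀₂ b₀₃ b₁₂ b₁₃ b₂₃ u₀ u₁ u₂ u₃ : Bool) → Bool
settled b₀₁ b₀₂ b₀₃ b₁₂ b₁₃ b₂₃ u₀ u₁ u₂ u₃ =
  one-of₄ b₀₁ b₀₂ b₀₃ u₀ ∧ (one-of₄ b₀₁ b₁₂ b₁₃ u₁ ∧ (one-of₄ b₀₂ b₁₂ b₂₃ u₂ ∧ one-of₄ b₀₃ b₁₃ b₂₃ u₃))

BaseColouring : (π₁₂ π₁₃ π₂₃ : Perm) (s₀ s₁ s₂ s₃ : Color) → Form
BaseColouring π₁₂ π₁₃ π₂₃ s₀ s₁ s₂ s₃ = ∃′ λ j₀ → ∃′ λ j₁ → ∃′ λ j₂ → ∃′ λ j₃ →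
  ⟨ settled (j₀ == j₁) (j₀ == j₂) (j₀ == j₃) (π₁₂ $ j₁ == j₂) (π₁₃ $ j₁ == j₃) (π₂₃ $ j₂ == j₃)
      (not (j₀ == s₀)) (not (j₁ == s₁)) (not (j₂ == s₂)) (not (j₃ == s₃)) ⟩

abstract
  base-colouring : ∀ π₁₂ π₁₃ π₂₃ s₀ s₁ s₂ s₃ → ⟦ BaseColouring π₁₂ π₁₃ π₂₃ s₀ s₁ s₂ s₃ ⟧
  base-colouring = decide (∀′ λ π₁₂ → ∀′ λ π₁₃ → ∀′ λ π₂₃ → ∀′ λ s₀ → ∀′ λ s₁ → ∀′ λ s₂ → ∀′ λ s₃ →
    BaseColouring π₁₂ π₁₃ π₂₃ s₀ s₁ s₂ s₃) refl

validBits : Vec Bool 17 → Bool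
validBits (wx ∷ vx ∷ wz ∷ vz ∷ wa ∷ vd ∷ xa ∷ za ∷ xd ∷ zd ∷ xp ∷ zq ∷ ap ∷ dp ∷ aq ∷ dq ∷ qp ∷ []) =
  valid wx vx wz vz wa vd xa za xd zd xp zq ap dp aq dq qp

-- Each row reduces by computation to a sum in `valid`, because the terms of non-neighbours vanish.
valid-rows : ∀ b → validBits b ≡ true → ∀ s → sum (λ t → bit (meet links b (suc (suc s)) t)) ≤ 1
valid-rows (wx ∷ vx ∷ wz ∷ vz ∷ wa ∷ vd ∷ xa ∷ za ∷ xd ∷ zd ∷ xp ∷ zq ∷ ap ∷ dp ∷ aq ∷ dq ∷ qp ∷ []) h = rows
  where
  h₁ = ∧-split {one-of₄ xp ap dp qp} h
  h₂ = ∧-split {one-of₄ zq aq dq qp} (proj₂ h₁)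
  h₃ = ∧-split {one-of₅ wx vx xa xd xp} (proj₂ h₂)
  h₄ = ∧-split {one-of₅ wz vz za zd zq} (proj₂ h₃)
  h₅ = ∧-split {one-of₅ wa xa za ap aq} (proj₂ h₄)
  rows : ∀ s → _
  rows zero                               = ≤ᵇ-true {bit wx + (bit vx + (bit xa + (bit xd + (bit xp + 0))))} (proj₁ h₃)
  rows (suc zero)                         = ≤ᵇ-true {bit wz + (bit vz + (bit za + (bit zd + (bit zq + 0))))} (proj₁ h₄)
  rows (suc (suc zero))                   = ≤ᵇ-true {bit wa + (bit xa + (bit za + (bit ap + (bit aq + 0))))} (proj₁ h₅)
  rows (suc (suc (suc zero)))             = ≤ᵇ-true {bit vd + (bit xd + (bit zd + (bit dp + (bit dq + 0))))} (proj₂ h₅)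
  rows (suc (suc (suc (suc zero))))       = ≤ᵇ-true {bit xp + (bit ap + (bit dp + (bit qp + 0)))} (proj₁ h₁)
  rows (suc (suc (suc (suc (suc zero))))) = ≤ᵇ-true {bit zq + (bit aq + (bit dq + (bit qp + 0)))} (proj₁ h₂)

move-last : ∀ a b c d → (a + (b + (c + 0))) + d ≡ a + (b + (c + (d + 0)))
move-last a b c d = trans (ℕₚ.+-assoc a (b + (c + 0)) d) (cong (a +_) (trans (ℕₚ.+-assoc b (c + 0) d)
  (cong (b +_) (trans (ℕₚ.+-assoc c 0 d) (cong (c +_) (≡-sym (ℕₚ.+-identityʳ d)))))))

settled-rows : ∀ b₀₁ b₀₂ b₀₃ b₁₂ b₁₃ b₂₃ (u : Fin 4 → Bool) →
  settled b₀₁ b₀₂ b₀₃ b₁₂ b₁₃ b₂₃ (u (# 0)) (u (# 1)) (u (# 2)) (u (# 3)) ≡ true →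
  ∀ i → degree4 (b₀₁ ∷ b₀₂ ∷ b₀₃ ∷ b₁₂ ∷ b₁₃ ∷ b₂₃ ∷ []) i + bit (u i) ≤ 1
settled-rows b₀₁ b₀₂ b₀₃ b₁₂ b₁₃ b₂₃ u h = rows
  where
  h₁ = ∧-split {one-of₄ b₀₁ b₀₂ b₀₃ (u (# 0))} h
  h₂ = ∧-split {one-of₄ b₀₁ b₁₂ b₁₃ (u (# 1))} (proj₂ h₁)
  h₃ = ∧-split {one-of₄ b₀₂ b₁₂ b₂₃ (u (# 2))} (proj₂ h₂)
  row : ∀ a b c d → one-of₄ a b c d ≡ true → (bit a + (bit b + (bit c + 0))) + bit d ≤ 1
  row a b c d p = subst (_≤ 1) (≡-sym (move-last (bit a) (bit b) (bit c) (bit d)))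
    (≤ᵇ-true {bit a + (bit b + (bit c + (bit d + 0)))} p)
  rows : ∀ i → degree4 (b₀₁ ∷ b₀₂ ∷ b₀₃ ∷ b₁₂ ∷ b₁₃ ∷ b₂₃ ∷ []) i + bit (u i) ≤ 1
  rows zero                   = row b₀₁ b₀₂ b₀₃ (u (# 0)) (proj₁ h₁)
  rows (suc zero)             = row b₀₁ b₁₂ b₁₃ (u (# 1)) (proj₁ h₂)
  rows (suc (suc zero))       = row b₀₂ b₁₂ b₂₃ (u (# 2)) (proj₁ h₃)
  rows (suc (suc (suc zero))) = row b₀₃ b₁₃ b₂₃ (u (# 3)) (proj₂ h₃)

-- The flags are compared with `R` only in the listed orientation of each edge; symmetry of `R`
-- gives the other.
meet-sound : ∀ {m n} (es : Vec (Fin n × Fin n) m) (b : Vec Bool m) (R : Fin n → Fin n → Bool) →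
  Pointwise (λ (s , t) b → R s t ≡ true → b ≡ true) es b → (∀ s t → R s t ≡ R t s) →
  ∀ s t → (find (joins es s t) ≡ nothing → R s t ≡ false) → R s t ≡ true → meet es b s t ≡ true
meet-sound es b R sound R-sym s t outside h with find (joins es s t) in eq
... | nothing = ⊥-elim (true≢false h (outside refl))
... | just l with joins-sound es s t eq | Pointwise.lookup sound l
...   | inj₁ q | k = subst (λ (s , t) → R s t ≡ true → lookup b l ≡ true) q k h
...   | inj₂ q | k = subst (λ (s , t) → R s t ≡ true → lookup b l ≡ true) q k (trans (R-sym t s) h)

at8 : Fin 4 → Fin 3 → Fin 8 → Vertex
at8 i k W             = i , hub
at8 i k V             = i , base
at8 i k (suc (suc s)) = i , inner k s

-- Naming the colours of a cover

record VertexCover : Set where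
  field
    shades     : Vertex → ℕ
    clash : ∀ u t → Fin (shades u) → Fin (shades t) → Bool
    symm     : ∀ u t a b → clash u t a b ≡ clash t u b a
    nonadj   : ∀ u t a b → adjV u t ≡ false → clash u t a b ≡ false
    matched : ∀ u t a b b′ → clash u t a b ≡ true → clash u t a b′ ≡ true → b ≡ b′
    three    : ∀ u → 3 ≤ shades u

module _ (H : VertexCover) where
  open VertexCover H

  -- Three colours of each list are selected, under names that can be permuted to simplify the
  -- matchings.
  record Naming (u : Vertex) : Set where
    constructor naming
    field
      name : Color → Fin (shades u)
      inj  : ∀ {c c′} → name c ≡ name c′ → c ≡ c′
  open Naming

  initial : ∀ u → Naming u
  initial u = naming (λ c → inject≤ c (three u)) (λ {c} {c′} → Fₚ.inject≤-injective (three u) (three u) c c′)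

  related : ∀ {u t} → Naming u → Naming t → Color → Color → Bool
  related {u} {t} ν μ c c′ = clash u t (name ν c) (name μ c′)

  related-perm : ∀ {u t} (ν : Naming u) (μ : Naming t) → Σ[ π ∈ Perm ] (∀ c c′ → related ν μ c c′ ≡ true → π $ c ≡ c′)
  related-perm {u} {t} ν μ = perfect (related ν μ)
    (λ c d d′ p q → inj μ (matched u t _ _ _ p q))
    (λ c c′ d p q → inj ν (matched t u _ _ _ (trans (symm t u _ _) p) (trans (symm t u _ _) q)))

  -- Renaming the colours of u after those of t makes the conflicts between u and t part of the identity.
  after : ∀ {t} → Naming t → ∀ u → Naming u
  after ν u = naming (λ c → name (initial u) (π $ c)) (λ p → $-injective π (inj (initial u) p))
    where π = proj₁ (related-perm ν (initial u))

  after-sound : ∀ {t} (ν : Naming t) u c c′ → related ν (after ν u) c c′ ≡ true → c ≡ c′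
  after-sound ν u c c′ p = $-injective (proj₁ (related-perm ν (initial u))) (proj₂ (related-perm ν (initial u)) c _ p)

  base-name : ∀ i → Naming (i , base)
  base-name zero    = initial (# 0 , base)
  base-name (suc i) = after (initial (# 0 , base)) (suc i , base)

  hub-name : ∀ i → Naming (i , hub)
  hub-name i = initial (i , hub)

  -- Follows the spanning forest used for `Gadget`: x, z and a are named after the hub, d after the
  -- base, q after z, and p after q.
  inner-name : ∀ i k s → Naming (i , inner k s)
  inner-name i k zero                               = after (hub-name i) (i , inner k (# 0))
  inner-name i k (suc zero)                         = after (hub-name i) (i , inner k (# 1))
  inner-name i k (suc (suc zero))                   = after (hub-name i) (i , inner k (# 2))
  inner-name i k (suc (suc (suc zero)))             = after (base-name i) (i , inner k (# 3))
  inner-name i k (suc (suc (suc (suc zero))))       = after (after (after (hub-name i) (i , inner k (# 1))) (i , inner k (# 5))) (i , inner k (# 4))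
  inner-name i k (suc (suc (suc (suc (suc zero))))) = after (after (hub-name i) (i , inner k (# 1))) (i , inner k (# 5))

  vertex-name : ∀ u → Naming u
  vertex-name (i , base)      = base-name i
  vertex-name (i , hub)       = hub-name i
  vertex-name (i , inner k s) = inner-name i k s

  perm : ∀ u t → Perm
  perm u t = proj₁ (related-perm (vertex-name u) (vertex-name t))

  perm-sound : ∀ u t c c′ → related (vertex-name u) (vertex-name t) c c′ ≡ true → perm u t $ c == c′ ≡ true
  perm-sound u t c c′ p = subst (λ d → perm u t $ c == d ≡ true)
    (proj₂ (related-perm (vertex-name u) (vertex-name t)) c c′ p) (==-refl (perm u t $ c))

  gadget : Fin 4 → Fin 3 → Gadget
  gadget i k = record
    { vx = π V X ; vz = π V Z ; xa = π X A′ ; za = π Z A′ ; xd = π X D′ ; zd = π Z D′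
    ; xp = π X P ; ap = π A′ P ; dp = π D′ P ; aq = π A′ Q ; dq = π D′ Q }
    where
    π : Fin 8 → Fin 8 → Perm
    π s t = perm (at8 i k s) (at8 i k t)

  linkBits : Fin 4 → Fin 3 → (Fin 8 → Color) → Vec Bool 17
  linkBits i k φ = let g = gadget i k in
    (φ W == φ X) ∷ (vx g $ φ V == φ X) ∷ (φ W == φ Z) ∷ (vz g $ φ V == φ Z) ∷ (φ W == φ A′) ∷ (φ V == φ D′) ∷
    (xa g $ φ X == φ A′) ∷ (za g $ φ Z == φ A′) ∷ (xd g $ φ X == φ D′) ∷ (zd g $ φ Z == φ D′) ∷
    (xp g $ φ X == φ P) ∷ (φ Z == φ Q) ∷ (ap g $ φ A′ == φ P) ∷ (dp g $ φ D′ == φ P) ∷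
    (aq g $ φ A′ == φ Q) ∷ (dq g $ φ D′ == φ Q) ∷ (φ Q == φ P) ∷ []

  clashes : ∀ u t (c c′ : Color) → Bool
  clashes u t c c′ = related (vertex-name u) (vertex-name t) c c′

  clashes-sym : ∀ u t c c′ → clashes u t c c′ ≡ clashes t u c′ c
  clashes-sym u t c c′ = symm u t _ _

  same-name : ∀ {c c′ : Color} → c ≡ c′ → c == c′ ≡ true
  same-name {c} refl = ==-refl c

  -- Along the edges of the forest a conflict forces equal names; along the others it is contained
  -- in the permutation stored in the gadget.
  bits-sound : ∀ i k φ → Pointwise
    (λ (s , t) b → clashes (at8 i k s) (at8 i k t) (φ s) (φ t) ≡ true → b ≡ true) links (linkBits i k φ)
  bits-sound i k φ =
    tree (hub-name i) X ∷ direct V X ∷ tree (hub-name i) Z ∷ direct V Z ∷ tree (hub-name i) A′ ∷ tree (base-name i) D′ ∷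
    direct X A′ ∷ direct Z A′ ∷ direct X D′ ∷ direct Z D′ ∷
    direct X P ∷ tree (inner-name i k (# 1)) Q ∷ direct A′ P ∷ direct D′ P ∷ direct A′ Q ∷ direct D′ Q ∷
    tree (inner-name i k (# 5)) P ∷ []
    where
    direct : ∀ s t → clashes (at8 i k s) (at8 i k t) (φ s) (φ t) ≡ true →
            perm (at8 i k s) (at8 i k t) $ φ s == φ t ≡ true
    direct s t = perm-sound (at8 i k s) (at8 i k t) (φ s) (φ t)
    tree : ∀ {u} (ν : Naming u) t {c} → related ν (after ν (at8 i k t)) c (φ t) ≡ true → c == φ t ≡ true
    tree ν t p = same-name (after-sound ν (at8 i k t) _ (φ t) p)

  adjV-at8 : ∀ i k s t → adjV (i , inner k s) (at8 i k t) ≡ adj8 (suc (suc s)) t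
  adjV-at8 i k s W             rewrite ==-refl i = refl
  adjV-at8 i k s V             rewrite ==-refl i = refl
  adjV-at8 i k s (suc (suc t)) rewrite ==-refl i | ==-refl k = refl

  gadget-sound : ∀ i k φ s t → let s′ = suc (suc s) in
    clashes (at8 i k s′) (at8 i k t) (φ s′) (φ t) ≡ true → meet links (linkBits i k φ) s′ t ≡ true
  gadget-sound i k φ s t = meet-sound links (linkBits i k φ) (λ s t → clashes (at8 i k s) (at8 i k t) (φ s) (φ t))
    (bits-sound i k φ) (λ s t → clashes-sym (at8 i k s) (at8 i k t) (φ s) (φ t)) (suc (suc s)) t
    (λ none → nonadj (i , inner k s) (at8 i k t) _ _ (trans (adjV-at8 i k s t) (cong is-just none)))

  base-perm : ∀ i i′ → Perm
  base-perm i i′ = perm (i , base) (i′ , base)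

  baseLinks : (Fin 4 → Color) → Vec Bool 6
  baseLinks = baseBits (base-perm (# 1) (# 2)) (base-perm (# 1) (# 3)) (base-perm (# 2) (# 3))

  base-bits-sound : ∀ j → Pointwise
    (λ (i , i′) b → clashes (i , base) (i′ , base) (j i) (j i′) ≡ true → b ≡ true) pairs4 (baseLinks j)
  base-bits-sound j = root (# 0) ∷ root (# 1) ∷ root (# 2) ∷ direct (# 1) (# 2) ∷ direct (# 1) (# 3) ∷ direct (# 2) (# 3) ∷ []
    where
    root : ∀ i {c} → related (base-name (# 0)) (base-name (suc i)) c (j (suc i)) ≡ true → c == j (suc i) ≡ true
    root i p = same-name (after-sound (base-name (# 0)) (suc i , base) _ _ p)
    direct : ∀ i i′ → clashes (i , base) (i′ , base) (j i) (j i′) ≡ true → base-perm i i′ $ j i == j i′ ≡ true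
    direct i i′ = perm-sound (i , base) (i′ , base) (j i) (j i′)

  complete4 : ∀ i i′ → ⟦ ⟨ i == i′ ⟩ ∨′ ⟨ is-just (find (joins pairs4 i i′)) ⟩ ⟧
  complete4 = decide (∀′ λ i → ∀′ λ i′ → ⟨ i == i′ ⟩ ∨′ ⟨ is-just (find (joins pairs4 i i′)) ⟩) refl

  base-sound : ∀ j i i′ → clashes (i , base) (i′ , base) (j i) (j i′) ≡ true → meet pairs4 (baseLinks j) i i′ ≡ true
  base-sound j i i′ = meet-sound pairs4 (baseLinks j) (λ i i′ → clashes (i , base) (i′ , base) (j i) (j i′))
    (base-bits-sound j) (λ i i′ → clashes-sym (i , base) (i′ , base) (j i) (j i′)) i i′
    (λ none → loop none (complete4 i i′))
    where
    loop : find (joins pairs4 i i′) ≡ nothing → ⟦ ⟨ i == i′ ⟩ ∨′ ⟨ is-just (find (joins pairs4 i i′)) ⟩ ⟧ →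
           clashes (i , base) (i′ , base) (j i) (j i′) ≡ false
    loop none (inj₂ q) = ⊥-elim (true≢false q (cong is-just none))
    loop none (inj₁ q) = nonadj (i , base) (i′ , base) _ _
      (subst (λ i′ → adjV (i , base) (i′ , base) ≡ false) (==-sound q) (adjV-irrefl (i , base)))

  spoke : Fin 4 → Perm
  spoke i = perm (i , base) (i , hub)

  safe : Fin 4 → Color
  safe i = proj₁ (safe-colour (spoke i) (gadget i))

  abstract
    base-colours : ∃ λ j → ∀ i → degree4 (baseLinks j) i + bit (not (j i == safe i)) ≤ 1
    base-colours = conclude (base-colouring (base-perm (# 1) (# 2)) (base-perm (# 1) (# 3)) (base-perm (# 2) (# 3))
        (safe (# 0)) (safe (# 1)) (safe (# 2)) (safe (# 3)))
      where
      conclude : ⟦ BaseColouring (base-perm (# 1) (# 2)) (base-perm (# 1) (# 3)) (base-perm (# 2) (# 3))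
        (safe (# 0)) (safe (# 1)) (safe (# 2)) (safe (# 3)) ⟧ →
        ∃ λ j → ∀ i → degree4 (baseLinks j) i + bit (not (j i == safe i)) ≤ 1
      conclude (j₀ , j₁ , j₂ , j₃ , h) = let j = quad j₀ j₁ j₂ j₃ in j , settled-rows (j₀ == j₁) (j₀ == j₂) (j₀ == j₃)
        (base-perm (# 1) (# 2) $ j₁ == j₂) (base-perm (# 1) (# 3) $ j₁ == j₃) (base-perm (# 2) (# 3) $ j₂ == j₃)
        (λ i → not (j i == safe i)) h

  baseColour : Fin 4 → Color
  baseColour = proj₁ base-colours

  base-degree : ∀ i → degree4 (baseLinks baseColour) i + bit (not (baseColour i == safe i)) ≤ 1
  base-degree = proj₂ base-colours

  blockAt : ∀ i → Block (spoke i) (gadget i) (baseColour i) (bit (not (baseColour i == safe i)))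
  blockAt i = proj₂ (safe-colour (spoke i) (gadget i)) (baseColour i)

  open Block
  open Extension

  inside-block : ∀ i k → Extension (gadget i k) (c (blockAt i)) (baseColour i) (inW (blockAt i) k) (inV (blockAt i) k)
  inside-block i k = extended (blockAt i) k

  -- The colouring and its conflicts

  colour : Vertex → Color
  colour (i , base)      = baseColour i
  colour (i , hub)       = c (blockAt i)
  colour (i , inner k s) = pick s
    where
    E = inside-block i k
    pick : Fin 6 → Color
    pick zero                               = x E
    pick (suc zero)                         = z E
    pick (suc (suc zero))                   = a E
    pick (suc (suc (suc zero)))             = d E
    pick (suc (suc (suc (suc zero))))       = p E
    pick (suc (suc (suc (suc (suc zero))))) = q E

  bits : Fin 4 → Fin 3 → Vec Bool 17
  bits i k = linkBits i k (λ s → colour (at8 i k s))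

  conflicting : Vertex → Vertex → Bool
  conflicting u t = clashes u t (colour u) (colour t)

  gadget-conflict : ∀ i k s t → conflicting (i , inner k s) (at8 i k t) ≡ true → meet links (bits i k) (suc (suc s)) t ≡ true
  gadget-conflict i k s t = gadget-sound i k (λ s → colour (at8 i k s)) s t

  meet-sym : ∀ b s t → meet links b s t ≡ meet links b t s
  meet-sym b s t = cong (maybe (lookup b) false) (link-sym s t)
    where
    same? : Maybe (Fin 17) → Maybe (Fin 17) → Bool
    same? (just l) (just l′) = l == l′
    same? nothing  nothing   = true
    same? _        _         = false
    same-sound : ∀ l l′ → same? l l′ ≡ true → l ≡ l′
    same-sound (just l) (just l′) h = cong just (==-sound h)
    same-sound nothing  nothing   h = refl
    link-sym : ∀ s t → link s t ≡ link t s
    link-sym s t = same-sound (link s t) (link t s) (decide (∀′ λ s → ∀′ λ t → ⟨ same? (link s t) (link t s) ⟩) refl s t)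

  gadget-conflict′ : ∀ i k t s → conflicting (at8 i k t) (i , inner k s) ≡ true → meet links (bits i k) t (suc (suc s)) ≡ true
  gadget-conflict′ i k t s h = trans (meet-sym (bits i k) t (suc (suc s)))
    (gadget-conflict i k s t (trans (clashes-sym (i , inner k s) (at8 i k t) _ _) h))

  adjacent : ∀ u t → conflicting u t ≡ true → adjV u t ≡ true
  adjacent u t h with adjV u t in eq
  ... | true  = refl
  ... | false = ⊥-elim (true≢false h (nonadj u t _ _ eq))

  data InnerNeighbour i k : Vertex → Set where
    within : ∀ t → InnerNeighbour i k (at8 i k t)

  inner-neighbour : ∀ i k s t → adjV (i , inner k s) t ≡ true → InnerNeighbour i k t
  inner-neighbour i k s (i′ , l) h with i == i′ in eq
  inner-neighbour i k s (i′ , base)       h | true with ==-sound {i = i} eq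
  ... | refl = within V
  inner-neighbour i k s (i′ , hub)        h | true with ==-sound {i = i} eq
  ... | refl = within W
  inner-neighbour i k s (i′ , inner k′ t) h | true with ==-sound {i = i} eq | ==-sound {i = k} (proj₁ (∧-split {k == k′} h))
  ... | refl | refl = within (suc (suc t))

  data HubNeighbour i : Vertex → Set where
    its-base : HubNeighbour i (i , base)
    its-inner : ∀ k s → HubNeighbour i (i , inner k s)

  hub-neighbour : ∀ i t → adjV (i , hub) t ≡ true → HubNeighbour i t
  hub-neighbour i (i′ , l) h with i == i′ in eq
  hub-neighbour i (i′ , base)      h | true with ==-sound {i = i} eq
  ... | refl = its-base
  hub-neighbour i (i′ , inner k t) h | true with ==-sound {i = i} eq
  ... | refl = its-inner k t

  data BaseNeighbour i : Vertex → Set where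
    other-base : ∀ i′ → BaseNeighbour i (i′ , base)
    its-hub    : BaseNeighbour i (i , hub)
    its-inner  : ∀ k s → BaseNeighbour i (i , inner k s)

  base-neighbour : ∀ i t → adjV (i , base) t ≡ true → BaseNeighbour i t
  base-neighbour i (i′ , base) h = other-base i′
  base-neighbour i (i′ , hub) h with i == i′ in eq
  ... | true with ==-sound {i = i} eq
  ...   | refl = its-hub
  base-neighbour i (i′ , inner k s) h with i == i′ in eq
  ... | true with ==-sound {i = i} eq
  ...   | refl = its-inner k s

  meets : Fin 4 → Fin 3 → Fin 8 → Fin 8 → ℕ
  meets i k s t = bit (meet links (bits i k) s t)

  inner-row : ∀ i k s → sum (meets i k (suc (suc s))) ≤ 1
  inner-row i k = valid-rows (bits i k) (ok (inside-block i k))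

  hub-row : ∀ i k → sum (meets i k W) ≤ inW (blockAt i) k
  hub-row i k = Extension.atW (inside-block i k)

  base-row : ∀ i k → sum (meets i k V) ≤ inV (blockAt i) k
  base-row i k = Extension.atV (inside-block i k)

  spoke-bit : Fin 4 → Bool
  spoke-bit i = spoke i $ baseColour i == c (blockAt i)

  spoke-conflict : ∀ i → conflicting (i , base) (i , hub) ≡ true → spoke-bit i ≡ true
  spoke-conflict i = perm-sound (i , base) (i , hub) (baseColour i) (c (blockAt i))

  -- Bounds for the conflicts at a hub or base vertex, one for each part of the graph around it.
  hubLoad : Fin 4 → Fin 4 → ℕ
  hubLoad i zero    = bit (spoke-bit i)
  hubLoad i (suc k) = inW (blockAt i) k

  baseLoad : Fin 4 → Fin 5 → ℕ
  baseLoad i zero          = degree4 (baseLinks baseColour) i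
  baseLoad i (suc zero)    = bit (spoke-bit i)
  baseLoad i (suc (suc k)) = inV (blockAt i) k

  hub-load : ∀ i → sum (hubLoad i) ≤ 1
  hub-load i = Block.atW (blockAt i)

  base-load : ∀ i → sum (baseLoad i) ≤ 1
  base-load i = ℕₚ.≤-trans (ℕₚ.+-monoʳ-≤ (degree4 (baseLinks baseColour) i) (Block.atV (blockAt i))) (base-degree i)

  hub-part : ∀ {i t} → HubNeighbour i t → Fin 4
  hub-part its-base        = zero
  hub-part (its-inner k s) = suc k

  base-part : ∀ {i t} → BaseNeighbour i t → Fin 5
  base-part (other-base i′)  = zero
  base-part its-hub          = suc zero
  base-part (its-inner k s)  = suc (suc k)

  met : ∀ i k s t → meet links (bits i k) s t ≡ true → 1 ≤ sum (meets i k s)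
  met i k s t h = ℕₚ.≤-trans (bit-1 h) (≤-sum (meets i k s) t)

  base-met : ∀ i i′ → conflicting (i , base) (i′ , base) ≡ true → 1 ≤ bit (meet pairs4 (baseLinks baseColour) i i′)
  base-met i i′ h = bit-1 (base-sound baseColour i i′ h)

  hub-part-load : ∀ {i t} (ν : HubNeighbour i t) → conflicting (i , hub) t ≡ true → 1 ≤ hubLoad i (hub-part ν)
  hub-part-load {i} its-base h = bit-1 (spoke-conflict i (trans (clashes-sym (i , base) (i , hub) _ _) h))
  hub-part-load {i} (its-inner k s) h = ℕₚ.≤-trans (met i k W (suc (suc s)) (gadget-conflict′ i k W s h)) (hub-row i k)

  base-part-load : ∀ {i t} (ν : BaseNeighbour i t) → conflicting (i , base) t ≡ true → 1 ≤ baseLoad i (base-part ν)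
  base-part-load {i} (other-base i′) h =
    ℕₚ.≤-trans (base-met i i′ h) (≤-sum (λ i′ → bit (meet pairs4 (baseLinks baseColour) i i′)) i′)
  base-part-load {i} its-hub h = bit-1 (spoke-conflict i h)
  base-part-load {i} (its-inner k s) h = ℕₚ.≤-trans (met i k V (suc (suc s)) (gadget-conflict′ i k V s h)) (base-row i k)

  single : Vertex → Set
  single u = ∀ t t′ → conflicting u t ≡ true → conflicting u t′ ≡ true → t ≡ t′

  same-inner : ∀ i k r s s′ → sum (meets i k r) ≤ 1 →
    conflicting (at8 i k r) (i , inner k s) ≡ true → conflicting (at8 i k r) (i , inner k s′) ≡ true →
    (i , inner k s) ≡ (i , inner k s′)
  same-inner i k r s s′ b h h′ = cong (λ s → i , inner k s) (Fₚ.suc-injective (Fₚ.suc-injective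
    (sum-unique (meets i k r) b (bit-1 (gadget-conflict′ i k r s h)) (bit-1 (gadget-conflict′ i k r s′ h′)))))

  inner-single : ∀ i k s → single (i , inner k s)
  inner-single i k s t t′ h h′
    with inner-neighbour i k s t (adjacent (i , inner k s) t h) | inner-neighbour i k s t′ (adjacent (i , inner k s) t′ h′)
  ... | within r | within r′ = cong (at8 i k)
    (sum-unique (meets i k (suc (suc s))) (inner-row i k s) (bit-1 (gadget-conflict i k s r h)) (bit-1 (gadget-conflict i k s r′ h′)))

  -- The loads of the parts around the hub add up to at most 1, so two conflicts lie in the same
  -- part. Within a gadget the row bound identifies the two neighbours.
  hub-single : ∀ i → single (i , hub)
  hub-single i t t′ h h′ = finish ν ν′ (sum-unique (hubLoad i) (hub-load i) (hub-part-load ν h) (hub-part-load ν′ h′)) h h′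
    where
    ν  = hub-neighbour i t (adjacent (i , hub) t h)
    ν′ = hub-neighbour i t′ (adjacent (i , hub) t′ h′)
    finish : ∀ {t t′} (ν : HubNeighbour i t) (ν′ : HubNeighbour i t′) → hub-part ν ≡ hub-part ν′ →
      conflicting (i , hub) t ≡ true → conflicting (i , hub) t′ ≡ true → t ≡ t′
    finish its-base        its-base         _    _ _  = refl
    finish (its-inner k s) (its-inner .k s′) refl h h′ = same-inner i k W s s′
      (ℕₚ.≤-trans (hub-row i k) (ℕₚ.≤-trans (≤-sum (hubLoad i) (suc k)) (hub-load i))) h h′

  base-single : ∀ i → single (i , base)
  base-single i t t′ h h′ = finish ν ν′ (sum-unique (baseLoad i) (base-load i) (base-part-load ν h) (base-part-load ν′ h′)) h h′
    where
    ν  = base-neighbour i t (adjacent (i , base) t h)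
    ν′ = base-neighbour i t′ (adjacent (i , base) t′ h′)
    finish : ∀ {t t′} (ν : BaseNeighbour i t) (ν′ : BaseNeighbour i t′) → base-part ν ≡ base-part ν′ →
      conflicting (i , base) t ≡ true → conflicting (i , base) t′ ≡ true → t ≡ t′
    -- All other base vertices form one part, whose load is the degree in K₄; that row sum is again
    -- at most 1.
    finish (other-base r)  (other-base r′)   _    h h′ = cong (_, base)
      (sum-unique (λ i′ → bit (meet pairs4 (baseLinks baseColour) i i′))
        (ℕₚ.≤-trans (≤-sum (baseLoad i) zero) (base-load i)) (base-met i r h) (base-met i r′ h′))
    finish its-hub         its-hub           _    _ _  = refl
    finish (its-inner k s) (its-inner .k s′) refl h h′ = same-inner i k V s s′
      (ℕₚ.≤-trans (base-row i k) (ℕₚ.≤-trans (≤-sum (baseLoad i) (suc (suc k))) (base-load i))) h h′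

  all-single : ∀ u → single u
  all-single (i , base)      = base-single i
  all-single (i , hub)       = hub-single i
  all-single (i , inner k s) = inner-single i k s

-- Transfer to covers of the numbered graph

module _ (H : Cover G₈₀) (k : KFold {G₈₀} 3 H) where
  vertexCover : VertexCover
  vertexCover = record
    { shades  = λ u → size H (encode u)
    ; clash   = λ u t → conflict H (encode u) (encode t)
    ; symm    = λ u t → conflict-sym H (encode u) (encode t)
    ; nonadj  = λ u t a b h → conflict-nonadj H (encode u) (encode t) a b
                  (trans (cong₂ adjV (decode-encode u) (decode-encode t)) h)
    ; matched = λ u t → conflict-matching H (encode u) (encode t)
    ; three   = λ u → k (encode u)
    }

  chosen : ∀ v → Fin (size H (encode v))
  chosen v = Naming.name (vertex-name vertexCover v) (colour vertexCover v)

  coloring : Coloring H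
  coloring u = subst (λ u → Fin (size H u)) (encode-decode u) (chosen (decode u))

  conflict-subst : ∀ {u u′ t t′} (p : u′ ≡ u) (q : t′ ≡ t) a b →
    conflict H u t (subst (λ u → Fin (size H u)) p a) (subst (λ u → Fin (size H u)) q b) ≡ conflict H u′ t′ a b
  conflict-subst refl refl a b = refl

  coloring-conflict : ∀ u t → conflict H u t (coloring u) (coloring t) ≡ conflicting vertexCover (decode u) (decode t)
  coloring-conflict u t = conflict-subst (encode-decode u) (encode-decode t) (chosen (decode u)) (chosen (decode t))

  decode-injective : ∀ {t t′} → decode t ≡ decode t′ → t ≡ t′
  decode-injective {t} {t′} p = trans (≡-sym (encode-decode t)) (trans (cong encode p) (encode-decode t′))

  defective : Defective H 1 coloring
  defective u = count-unique (λ t → conflict H u t (coloring u) (coloring t)) λ t t′ h h′ →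
    decode-injective (all-single vertexCover (decode u) (decode t) (decode t′)
      (trans (≡-sym (coloring-conflict u t)) h) (trans (≡-sym (coloring-conflict u t′)) h′))

1-defective-3-correspondable : DefectiveCorrespondable 1 3 G₈₀
1-defective-3-correspondable H k = coloring H k , defective H k

theorem1p3 : Σ Graph λ G → Planar G × DefectiveCorrespondable 1 3 G × ¬ Correspondable 4 G
theorem1p3 = G₈₀ , planar , 1-defective-3-correspondable , not-4-correspondable
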